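{- Let $\alpha,\lambda,m,n$ be positive integers. If $\lambda mK_n$ admits an $\alpha$-resolvable $(c_1,\ldots,c_k)$-cycle decomposition, then $\lambda K_{n\times m}$ admits an $\alpha$-resolvable $(c_1m,\ldots,c_km)$-cycle decomposition.
   Context: $\lambda K_n$: complete multigraph on $n$ vertices with $\lambda$ parallel edges between each pair; $\lambda K_{n\times m}$: complete $\lambda$-fold $n$-partite multigraph with $n$ parts of size $m$. A cycle decomposition of $\mathcal{G}$ is an edge-partition into cycles (or into cycles and a single 1-factor if every vertex has odd degree); a $(c_1,\ldots,c_k)$-cycle decomposition has $k$ cycles of lengths $c_1,\ldots,c_k$. It is $\alpha$-resolvable if the cycles can be partitioned into classes such that each vertex lies in exactly $\alpha$ cycles of each class. -}

module Defs where

open import Data.Nat using (ℕ; zero; suc; _+_; _*_; _≤_)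
open import Data.Nat.Properties using ()
open import Data.Bool using (Bool; true; false; _∧_; _∨_; if_then_else_)
open import Data.Fin as Fin using (Fin; quotient)
open import Data.List using (List; []; _∷_; length; map; concat; allFin)
open import Data.Nat.ListAction using (sum)
open import Data.List.Relation.Unary.All using (All)
open import Data.List.Relation.Unary.Unique.Propositional using (Unique)
open import Data.List.Relation.Binary.Permutation.Propositional using (_↭_)
open import Function using (_∘_)
open import Data.Product using (Σ; _×_; _,_)
open import Data.Sum using (_⊎_)
open import Relation.Nullary.Decidable using (does)
open import Relation.Binary.PropositionalEquality using (_≡_; _≢_)

countWhere : {A : Set} → (A → Bool) → List A → ℕ
countWhere p [] = 0
countWhere p (x ∷ xs) = (if p x then 1 else 0) + countWhere p xs

_==_ : {N : ℕ} → Fin N → Fin N → Bool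
u == v = does (u Fin.≟ v)

-- A multigraph on vertex set Fin N is given by its edge multiplicities
-- mult u v (only used for u ≢ v; no loops).
Mult : ℕ → Set
Mult N = Fin N → Fin N → ℕ

completeMult : (n l : ℕ) → Mult n
completeMult n l u v = if u == v then 0 else l

partiteMult : (n m l : ℕ) → Mult (n * m)
partiteMult n m l u v = if _==_ {n} (quotient m u) (quotient m v) then 0 else l

degree : {N : ℕ} → Mult N → Fin N → ℕ
degree {N} mult v = sum (map (mult v) (allFin N))

-- A cycle (v₀, v₁, …, v_{c-1}) is a list of distinct vertices of length ≥ 2
-- (2-cycles are allowed in multigraphs: they use two parallel edges).
IsCycle : {N : ℕ} → List (Fin N) → Set
IsCycle C = Unique C × (2 ≤ length C)

cycleEdges : {N : ℕ} → List (Fin N) → List (Fin N × Fin N)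
cycleEdges [] = []
cycleEdges (x₀ ∷ xs) = go (x₀ ∷ xs)
  where
  go : List _ → List _
  go [] = []
  go (a ∷ []) = (a , x₀) ∷ []
  go (a ∷ b ∷ t) = (a , b) ∷ go (b ∷ t)

isEdge : {N : ℕ} → Fin N → Fin N → Fin N × Fin N → Bool
isEdge u v (a , b) = ((a == u) ∧ (b == v)) ∨ ((a == v) ∧ (b == u))

countEdge : {N : ℕ} → Fin N → Fin N → List (Fin N × Fin N) → ℕ
countEdge u v = countWhere (isEdge u v)

incidences : {N : ℕ} → Fin N → List (Fin N × Fin N) → ℕ
incidences v [] = 0
incidences v ((a , b) ∷ F) =
  (if a == v then 1 else 0) + (if b == v then 1 else 0) + incidences v F

IsOneFactor : {N : ℕ} → List (Fin N × Fin N) → Set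
IsOneFactor {N} F = ∀ (v : Fin N) → incidences v F ≡ 1

data Odd : ℕ → Set where
  one : Odd 1
  ss  : ∀ {n} → Odd n → Odd (suc (suc n))

record CycleDecomp (N : ℕ) (mult : Mult N) (cs : List ℕ) : Set where
  field
    cycles     : List (List (Fin N))
    areCycles  : All IsCycle cycles
    lengths    : map length cycles ≡ cs
    oneFactor  : List (Fin N × Fin N)
    factorOK   : (oneFactor ≡ []) ⊎
                 ((∀ (v : Fin N) → Odd (degree mult v)) × IsOneFactor oneFactor)
    partition  : ∀ (u v : Fin N) → u ≢ v →
                 sum (map (countEdge u v ∘ cycleEdges) cycles) + countEdge u v oneFactor
                   ≡ mult u v

open CycleDecomp public

occurs : {N : ℕ} → Fin N → List (Fin N) → Bool
occurs v [] = false
occurs v (x ∷ C) = (x == v) ∨ occurs v C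

cyclesThrough : {N : ℕ} → Fin N → List (List (Fin N)) → ℕ
cyclesThrough v = countWhere (occurs v)

Resolvable : {N : ℕ} {mult : Mult N} {cs : List ℕ} → ℕ → CycleDecomp N mult cs → Set
Resolvable {N} α D =
  Σ (List (List (List (Fin N)))) λ classes →
    (concat classes ↭ cycles D) ×
    All (λ cl → ∀ (v : Fin N) → cyclesThrough v cl ≡ α) classes

AdmitsResolvable : (α N : ℕ) → Mult N → List ℕ → Set
AdmitsResolvable α N mult cs = Σ (CycleDecomp N mult cs) (Resolvable α)

{-# OPTIONS --safe #-}
module Submission where

-- Label the parallel edges between two vertices of l m K_n by 0, …, l m − 1 and replace the edge with label t by the
-- perfect matching {(a , i) (b , j) : i + j ≡ t (mod m)}. This decomposes the equipartite multigraph into 2-regular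
-- graphs, one over each given cycle, possibly disconnected, and lifts the 1-factor to a 1-factor. They are made
-- connected by re-splitting twins p, q, two vertices of the same part. If p and q are merged, each 2-regular graph
-- through their part has two loops at the merged vertex, since twins are not adjacent; splitting it again so that
-- every loop has one end at p and one at q gives a graph in which p and q lie on a common cycle, and no two vertices
-- become disconnected. The choice for all loops, and for the two factor edges at p and q, is an orientation of an
-- arc between the two ends. Every vertex is an end of an even number of arcs, because p and q see it equally often,
-- so an orientation with equal in- and outdegrees exists and restores the edge multiplicities. Once all twins have
-- been treated, each 2-regular graph is a single cycle over the given one, so resolution classes are preserved.

open import Defs
open import Data.Bool using (Bool; true; false; _∧_; _∨_; if_then_else_)
open import Data.Bool.Properties using (∧-comm; ∨-comm; ∧-zeroʳ; ∨-identityʳ)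
open import Data.Fin as Fin using (Fin; zero; suc; quotient; combine; toℕ; _↑ˡ_; _↑ʳ_)
open import Data.Fin.Properties using (combine-injective; remQuot-combine; combine-remQuot; toℕ-fromℕ<)
open import Data.List using (List; []; _∷_; _++_; _∷ʳ_; length; map; concat; allFin; reverse; tabulate; cartesianProduct)
open import Data.List.Membership.Propositional using (_∈_)
open import Data.List.Membership.Propositional.Properties using (∈-allFin; ∈-cartesianProduct⁺; ∈-map⁺; ∈-++⁺ˡ)
open import Data.List.Properties using (++-assoc; ++-identityʳ; unfold-reverse; reverse-++)
open import Data.List.Relation.Binary.Permutation.Propositional using (_↭_; refl; prep; swap; trans; ↭-refl; ↭-sym; ↭-trans)
open import Data.List.Relation.Binary.Permutation.Propositional.Properties using (map⁺; ↭-map-inv; ↭-length; ↭-reverse)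
open import Data.List.Relation.Binary.Pointwise using (Pointwise; []; _∷_)
open import Data.List.Relation.Unary.All as All using (All; []; _∷_)
open import Data.List.Relation.Unary.All.Properties using () renaming (++⁺ to All-++⁺; map⁺ to All-map⁺)
open import Data.List.Relation.Unary.AllPairs using ([]; _∷_)
open import Data.List.Relation.Unary.Any as Any using (Any; here; there)
open import Data.List.Relation.Unary.Unique.Propositional using (Unique)
open import Data.Nat using (ℕ; zero; suc; _+_; _*_; _≤_; _<_; z≤n; s≤s; _%_; _≡ᵇ_; NonZero)
open import Data.Nat.DivMod using (m%n%n≡m%n; m%n<n; [m+n]%n≡m%n; m<n⇒m%n≡m)
open import Data.Nat.ListAction using (sum)
open import Data.Nat.ListAction.Properties using (sum-↭)
open import Data.Nat.Properties
open import Data.Nat.Tactic.RingSolver using (solve-∀)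
open import Data.Product using (Σ; ∃; ∃₂; _×_; _,_; proj₁; proj₂)
open import Data.Sum using (_⊎_; inj₁; inj₂)
open import Function using (_∘_; case_of_)
open import Relation.Binary.PropositionalEquality as ≡ using (_≡_; _≢_; refl; sym; cong; cong₂; subst; module ≡-Reasoning)
open import Relation.Nullary using (¬_; yes; no; contradiction)
open import Relation.Nullary.Decidable using (dec-true; dec-false)
open import Algebra.Properties.Semiring.Sum +-*-semiring using (∑-distrib-+; ∑-comm; sum-cong-≗; *-distribʳ-sum; *-distribˡ-sum; sum-replicate-zero) renaming (sum to ∑)

-- This is amalgamation and detachment, done for two vertices at a time. The obstacle is that making
-- one colour connected changes how often p and q meet the other vertices, and a colour cannot
-- repair this by itself. But either direction of an arc yields a trail through both p and q, so
-- connectivity leaves every direction free, and all colours together can spend this freedom on the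
-- multiplicities: of the arc ends at w, a balanced orientation attaches half to p and half to q.
-- The 1-factor has to take part because only colours and factor together meet p and q equally
-- often. The initial lift therefore has to get only counts and degrees right and to place some edge
-- above each base edge; its connectivity is irrelevant. Trails are plain lists of vertices
-- throughout, and that they are simple follows from every vertex occurring at most once in a
-- colour.

private
  variable
    X Y : Set
    N n : ℕ

-- Counting occurrences, edges and incidences

exchange : ∀ a b c → a + (b + c) ≡ b + (a + c)
exchange = solve-∀

𝟙 : Bool → ℕ
𝟙 b = if b then 1 else 0

==-≡ : {a b : Fin N} → a ≡ b → (a == b) ≡ true
==-≡ {a = a} {b} = dec-true (a Fin.≟ b)

==-≢ : {a b : Fin N} → a ≢ b → (a == b) ≡ false
==-≢ {a = a} {b} = dec-false (a Fin.≟ b)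

==-sym : (a b : Fin N) → (a == b) ≡ (b == a)
==-sym a b with a Fin.≟ b
... | yes a≡b = sym (==-≡ (sym a≡b))
... | no a≢b  = sym (==-≢ (a≢b ∘ sym))

countWhere-++ : (p : X → Bool) (xs ys : List X) →
  countWhere p (xs ++ ys) ≡ countWhere p xs + countWhere p ys
countWhere-++ p [] ys = refl
countWhere-++ p (x ∷ xs) ys = ≡.trans (cong (𝟙 (p x) +_) (countWhere-++ p xs ys)) (sym (+-assoc (𝟙 (p x)) _ _))

countWhere-↭ : (p : X → Bool) {xs ys : List X} → xs ↭ ys → countWhere p xs ≡ countWhere p ys
countWhere-↭ p refl = refl
countWhere-↭ p (prep x r) = cong (𝟙 (p x) +_) (countWhere-↭ p r)
countWhere-↭ p (swap x y r) rewrite countWhere-↭ p r = exchange (𝟙 (p x)) (𝟙 (p y)) _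
countWhere-↭ p (trans r s) = ≡.trans (countWhere-↭ p r) (countWhere-↭ p s)

countWhere-cong : {p q : X → Bool} → (∀ x → p x ≡ q x) → ∀ xs → countWhere p xs ≡ countWhere q xs
countWhere-cong p≗q [] = refl
countWhere-cong p≗q (x ∷ xs) = cong₂ (λ b k → 𝟙 b + k) (p≗q x) (countWhere-cong p≗q xs)

occurrences : Fin N → List (Fin N) → ℕ
occurrences v = countWhere (_== v)

occurrences-reverse : (v : Fin N) (L : List (Fin N)) → occurrences v (reverse L) ≡ occurrences v L
occurrences-reverse v L = countWhere-↭ (_== v) (↭-reverse L)

isEdge-sym : (u v : Fin N) (e : Fin N × Fin N) → isEdge u v e ≡ isEdge v u e
isEdge-sym u v (a , b) = ∨-comm ((a == u) ∧ (b == v)) _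

isEdge-flip : (u v a b : Fin N) → isEdge u v (b , a) ≡ isEdge u v (a , b)
isEdge-flip u v a b = ≡.trans
  (cong₂ _∨_ (∧-comm (b == u) (a == v)) (∧-comm (b == v) (a == u)))
  (∨-comm ((a == v) ∧ (b == u)) _)

countEdge-sym : (u v : Fin N) (E : List (Fin N × Fin N)) → countEdge u v E ≡ countEdge v u E
countEdge-sym u v = countWhere-cong (isEdge-sym u v)

incidences-++ : (v : Fin N) (E E' : List (Fin N × Fin N)) →
  incidences v (E ++ E') ≡ incidences v E + incidences v E'
incidences-++ v [] E' = refl
incidences-++ v ((a , b) ∷ E) E' = ≡.trans
  (cong (𝟙 (a == v) + 𝟙 (b == v) +_) (incidences-++ v E E'))
  (sym (+-assoc (𝟙 (a == v) + 𝟙 (b == v)) _ _))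

incidences-↭ : (v : Fin N) {E E' : List (Fin N × Fin N)} → E ↭ E' → incidences v E ≡ incidences v E'
incidences-↭ v refl = refl
incidences-↭ v (prep (a , b) r) = cong (𝟙 (a == v) + 𝟙 (b == v) +_) (incidences-↭ v r)
incidences-↭ v (swap (a , b) (c , d) r) rewrite incidences-↭ v r =
  exchange (𝟙 (a == v) + 𝟙 (b == v)) (𝟙 (c == v) + 𝟙 (d == v)) _
incidences-↭ v (trans r s) = ≡.trans (incidences-↭ v r) (incidences-↭ v s)

-- Paths and cycles as lists of vertices

pathEdges : List (Fin N) → List (Fin N × Fin N)
pathEdges [] = []
pathEdges (a ∷ []) = []
pathEdges (a ∷ b ∷ t) = (a , b) ∷ pathEdges (b ∷ t)

-- walkFrom is solved to be the local function go of cycleEdges, which cannot be named directly.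
mutual
  walkFrom : Fin N → List (Fin N) → List (Fin N) → List (Fin N × Fin N)
  walkFrom = _

  cycleEdges-walkFrom : (x : Fin N) (xs : List (Fin N)) → cycleEdges (x ∷ xs) ≡ walkFrom x xs (x ∷ xs)
  cycleEdges-walkFrom x xs with x ∷ xs
  ... | ys = refl

walkFrom-pathEdges : (x : Fin N) (xs : List (Fin N)) (a : Fin N) (t : List (Fin N)) →
  walkFrom x xs (a ∷ t) ≡ pathEdges (a ∷ t ++ x ∷ [])
walkFrom-pathEdges x xs a [] = refl
walkFrom-pathEdges x xs a (b ∷ t) = cong ((a , b) ∷_) (walkFrom-pathEdges x xs b t)

-- Repeating the first vertex at the end turns a cycle into a path, so that cutting, rotating and
-- reversing cycles reduce to `pathEdges-++` and `pathCount-reverse`.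
cycleEdges-pathEdges : (x : Fin N) (xs : List (Fin N)) →
  cycleEdges (x ∷ xs) ≡ pathEdges (x ∷ xs ++ x ∷ [])
cycleEdges-pathEdges x xs = ≡.trans (cycleEdges-walkFrom x xs) (walkFrom-pathEdges x xs x xs)

pathEdges-++ : (xs : List (Fin N)) (z : Fin N) (ys : List (Fin N)) →
  pathEdges (xs ++ z ∷ ys) ≡ pathEdges (xs ++ z ∷ []) ++ pathEdges (z ∷ ys)
pathEdges-++ [] z ys = refl
pathEdges-++ (x ∷ []) z ys = refl
pathEdges-++ (x ∷ y ∷ xs) z ys = cong ((x , y) ∷_) (pathEdges-++ (y ∷ xs) z ys)

pathCount : Fin N → Fin N → List (Fin N) → ℕ
pathCount u v L = countEdge u v (pathEdges L)

pathCount-++ : (u v : Fin N) (xs : List (Fin N)) (z : Fin N) (ys : List (Fin N)) →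
  pathCount u v (xs ++ z ∷ ys) ≡ pathCount u v (xs ++ z ∷ []) + pathCount u v (z ∷ ys)
pathCount-++ u v xs z ys rewrite pathEdges-++ xs z ys = countWhere-++ (isEdge u v) (pathEdges (xs ++ z ∷ [])) _

pathCount-reverse : (u v : Fin N) (L : List (Fin N)) → pathCount u v (reverse L) ≡ pathCount u v L
pathCount-reverse u v [] = refl
pathCount-reverse u v (x ∷ []) = refl
pathCount-reverse u v (x ∷ y ∷ L) = begin
  pathCount u v (reverse (x ∷ y ∷ L))
    ≡⟨ cong (pathCount u v) eq ⟩
  pathCount u v (reverse L ++ y ∷ x ∷ [])
    ≡⟨ pathCount-++ u v (reverse L) y (x ∷ []) ⟩
  pathCount u v (reverse L ++ y ∷ []) + (𝟙 (isEdge u v (y , x)) + 0)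
    ≡⟨ cong₂ _+_ (≡.trans (cong (pathCount u v) (sym (unfold-reverse y L))) (pathCount-reverse u v (y ∷ L)))
         (≡.trans (+-identityʳ _) (cong 𝟙 (isEdge-flip u v x y))) ⟩
  pathCount u v (y ∷ L) + 𝟙 (isEdge u v (x , y))
    ≡⟨ +-comm (pathCount u v (y ∷ L)) _ ⟩
  pathCount u v (x ∷ y ∷ L) ∎
  where
  open ≡-Reasoning
  eq : reverse (x ∷ y ∷ L) ≡ reverse L ++ y ∷ x ∷ []
  eq rewrite unfold-reverse x (y ∷ L) | unfold-reverse y L = ++-assoc (reverse L) (y ∷ []) (x ∷ [])

cycleCount : Fin N → Fin N → List (Fin N) → ℕ
cycleCount u v = countEdge u v ∘ cycleEdges

cycleCount-∷ : (u v x : Fin N) (xs : List (Fin N)) → cycleCount u v (x ∷ xs) ≡ pathCount u v (x ∷ xs ++ x ∷ [])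
cycleCount-∷ u v x xs = cong (countEdge u v) (cycleEdges-pathEdges x xs)

cyclesCount : Fin N → Fin N → List (List (Fin N)) → ℕ
cyclesCount u v W = sum (map (cycleCount u v) W)

-- Eulerian orientations and closed trails

-- A constructor of Eulerian undoes one step of tracing a closed trail.
data Eulerian {N : ℕ} : List (Fin N × Fin N) → Set where
  done : Eulerian []
  loop : ∀ {x L} → Eulerian L → Eulerian ((x , x) ∷ L)
  join : ∀ {x y z L} → Eulerian ((x , z) ∷ L) → Eulerian ((x , y) ∷ (y , z) ∷ L)
  flip : ∀ {x y L} → Eulerian ((x , y) ∷ L) → Eulerian ((y , x) ∷ L)
  perm : ∀ {L L'} → L ↭ L' → Eulerian L → Eulerian L'

extract : (y : Fin N) (L : List (Fin N × Fin N)) → incidences y L ≢ 0 →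
  ∃₂ λ z L' → (L ↭ (y , z) ∷ L') ⊎ (L ↭ (z , y) ∷ L')
extract y [] ne = contradiction refl ne
extract y ((a , b) ∷ L) ne with a Fin.≟ y
... | yes refl = b , L , inj₁ ↭-refl
... | no _ with b Fin.≟ y
...   | yes refl = a , L , inj₂ ↭-refl
...   | no _ with extract y L ne
...     | z , L' , inj₁ r = z , (a , b) ∷ L' , inj₁ (↭-trans (prep _ r) (swap _ _ ↭-refl))
...     | z , L' , inj₂ r = z , (a , b) ∷ L' , inj₂ (↭-trans (prep _ r) (swap _ _ ↭-refl))

Even : ℕ → Set
Even k = ∃ λ h → k ≡ h + h

even-cancel : ∀ k → Even (2 + k) → Even k
even-cancel k (zero , ())
even-cancel k (suc h , eq) = h , suc-injective (suc-injective (≡.trans eq (cong suc (+-suc h h))))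

even-strip : ∀ a k → Even (a + a + k) → Even k
even-strip zero k e = e
even-strip (suc a) k e = even-strip a k (even-cancel _ (subst Even (shift a k) e))
  where
  shift : ∀ a k → suc a + suc a + k ≡ 2 + (a + a + k)
  shift = solve-∀

-- Cutting the corner at y removes two edge ends there and changes no other degree. A loop counts
-- twice in `incidences`, so coinciding vertices are covered as well.
even-join : (x y z : Fin N) (L L' : List (Fin N × Fin N)) →
  (∀ v → Even (incidences v ((x , y) ∷ L))) → (∀ v → incidences v L ≡ incidences v ((y , z) ∷ L')) →
  ∀ v → Even (incidences v ((x , z) ∷ L'))
even-join x y z L L' ev eq v = even-strip (𝟙 (y == v)) _ (subst Even
  (≡.trans (cong (𝟙 (x == v) + 𝟙 (y == v) +_) (eq v)) (regroup (𝟙 (x == v)) (𝟙 (y == v)) (𝟙 (z == v)) (incidences v L')))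
  (ev v))
  where
  regroup : ∀ a b c d → a + b + (b + c + d) ≡ b + b + (a + c + d)
  regroup = solve-∀

-- A trail is traced: the head (x , y), unless it is a loop, contributes one to the even degree of
-- y, so another edge continues it, and a shortcut replaces the two. The length k serves as the
-- measure, since the shortened list is not structurally smaller.
even⇒Eulerian : ∀ k (L : List (Fin N × Fin N)) → length L ≡ k →
  (∀ v → Even (incidences v L)) → Eulerian L
even⇒Eulerian _ [] _ _ = done
even⇒Eulerian (suc k) ((x , y) ∷ L) len ev with x Fin.≟ y
... | yes refl = loop (even⇒Eulerian k L (suc-injective len) λ v → even-strip (𝟙 (x == v)) _ (ev v))
... | no x≢y with extract y L y∈L
  where
  y∈L : incidences y L ≢ 0
  y∈L eq with ev y
  ... | h , e rewrite ==-≢ x≢y | ==-≡ {a = y} refl | eq = odd h e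
    where
    odd : ∀ h → 1 ≢ h + h
    odd (suc zero) ()
    odd (suc (suc h)) ()
... | z , L' , inj₁ r = perm (prep _ (↭-sym r))
        (join (even⇒Eulerian k ((x , z) ∷ L') (≡.trans (sym (↭-length r)) (suc-injective len))
          (even-join x y z L L' ev λ v → incidences-↭ v r)))
-- `flip` acts on the first edge only, so an edge stored as (z , y) is moved to the front, turned
-- there and moved back.
... | z , L' , inj₂ r = perm (↭-trans (swap _ _ ↭-refl) (prep _ (↭-sym r)))
        (flip (perm (swap _ _ ↭-refl)
          (join (even⇒Eulerian k ((x , z) ∷ L') (≡.trans (sym (↭-length r)) (suc-injective len))
            (even-join x y z L L' ev λ v → ≡.trans (incidences-↭ v r)
              (cong (_+ incidences v L') (+-comm (𝟙 (z == v)) _)))))))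

data Orients {N : ℕ} : Fin N × Fin N → Fin N × Fin N → Set where
  keep : ∀ {x y} → Orients (x , y) (x , y)
  turn : ∀ {x y} → Orients (x , y) (y , x)

outdegree indegree : Fin N → List (Fin N × Fin N) → ℕ
outdegree v = countWhere (λ e → proj₁ e == v)
indegree v = countWhere (λ e → proj₂ e == v)

Pointwise-↭ : {R : X → Y → Set} {xs xs' : List X} {ys : List Y} → xs ↭ xs' → Pointwise R xs ys →
  ∃ λ ys' → Pointwise R xs' ys' × (ys ↭ ys')
Pointwise-↭ refl rs = _ , rs , ↭-refl
Pointwise-↭ (prep x p) (r ∷ rs) with Pointwise-↭ p rs
... | _ , rs' , q = _ , r ∷ rs' , prep _ q
Pointwise-↭ (swap x y p) (r ∷ s ∷ rs) with Pointwise-↭ p rs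
... | _ , rs' , q = _ , s ∷ r ∷ rs' , swap _ _ q
Pointwise-↭ (trans p p') rs with Pointwise-↭ p rs
... | _ , rs' , q with Pointwise-↭ p' rs'
...   | _ , rs'' , q' = _ , rs'' , ↭-trans q q'

Pointwise-++⁻ : {R : X → Y → Set} (xs : List X) {xs' : List X} {zs : List Y} → Pointwise R (xs ++ xs') zs →
  ∃₂ λ ys ys' → zs ≡ ys ++ ys' × Pointwise R xs ys × Pointwise R xs' ys'
Pointwise-++⁻ [] rs = [] , _ , refl , [] , rs
Pointwise-++⁻ (x ∷ xs) (r ∷ rs) with Pointwise-++⁻ xs rs
... | _ , _ , refl , ps , qs = _ , _ , refl , r ∷ ps , qs

-- When a shortcut is undone, both edges follow its direction: y gains one incoming and one outgoing
-- edge, while x and z keep their degrees. A loop adds one to both degrees of its vertex. `flip`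
-- leaves the directed edge as it is and only exchanges `keep` and `turn`.
balancedOrientation : {L : List (Fin N × Fin N)} → Eulerian L →
  ∃ λ M → Pointwise Orients L M × (∀ v → outdegree v M ≡ indegree v M)
balancedOrientation done = [] , [] , λ v → refl
balancedOrientation (loop {x} e) with balancedOrientation e
... | M , o , bal = (x , x) ∷ M , keep ∷ o , λ v → cong (𝟙 (x == v) +_) (bal v)
balancedOrientation (join {x} {y} {z} e) with balancedOrientation e
... | .(x , z) ∷ M , keep ∷ o , bal = (x , y) ∷ (y , z) ∷ M , keep ∷ keep ∷ o , λ v →
      ≡.trans (exchange (𝟙 (x == v)) (𝟙 (y == v)) _) (cong (𝟙 (y == v) +_) (bal v))
... | .(z , x) ∷ M , turn ∷ o , bal = (y , x) ∷ (z , y) ∷ M , turn ∷ turn ∷ o , λ v →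
      ≡.trans (cong (𝟙 (y == v) +_) (bal v)) (exchange (𝟙 (y == v)) (𝟙 (x == v)) _)
balancedOrientation (flip {x} {y} e) with balancedOrientation e
... | _ ∷ M , keep ∷ o , bal = (x , y) ∷ M , turn ∷ o , bal
... | _ ∷ M , turn ∷ o , bal = (y , x) ∷ M , keep ∷ o , bal
balancedOrientation (perm r e) with balancedOrientation e
... | M , o , bal with Pointwise-↭ r o
...   | M' , o' , q = M' , o' , λ v →
        ≡.trans (sym (countWhere-↭ _ q)) (≡.trans (bal v) (countWhere-↭ _ q))

orients-incidences : {L M : List (Fin N × Fin N)} → Pointwise Orients L M →
  ∀ v → incidences v L ≡ outdegree v M + indegree v M
orients-incidences [] v = refl
orients-incidences (keep {x} {y} ∷ o) v rewrite orients-incidences o v = regroup (𝟙 (x == v)) (𝟙 (y == v)) _ _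
  where
  regroup : ∀ a b c d → a + b + (c + d) ≡ a + c + (b + d)
  regroup = solve-∀
orients-incidences (turn {x} {y} ∷ o) v rewrite orients-incidences o v = regroup (𝟙 (x == v)) (𝟙 (y == v)) _ _
  where
  regroup : ∀ a b c d → a + b + (c + d) ≡ b + c + (a + d)
  regroup = solve-∀

occurrences-++ : (v : Fin N) (xs ys : List (Fin N)) →
  occurrences v (xs ++ ys) ≡ occurrences v xs + occurrences v ys
occurrences-++ v = countWhere-++ (_== v)

-- A path from the first to the last component with the given interior. In `closeSegments` each edge
-- of an Eulerian list is the shortcut for such a path.
Segment : ℕ → Set
Segment N = Fin N × List (Fin N) × Fin N

ends : Segment N → Fin N × Fin N
ends (x , I , y) = x , y

segmentCount : Fin N → Fin N → Segment N → ℕ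
segmentCount u v (x , I , y) = pathCount u v (x ∷ I ++ y ∷ [])

-- The degree of v in the path: an interior visit uses two edges, an end one.
segmentWeight : Fin N → Segment N → ℕ
segmentWeight v (x , I , y) = occurrences v I + occurrences v I + (𝟙 (x == v) + 𝟙 (y == v))

-- The constructors are replayed on paths: `join` concatenates two of them at y, `flip` reverses
-- one, `loop` closes one up. Visits are counted doubled, because an end is half a visit until two
-- ends are fused.
closeSegments : {L : List (Fin N × Fin N)} → Eulerian L → (S : List (Segment N)) → map ends S ≡ L →
  ∃ λ W → (∀ u v → cyclesCount u v W ≡ sum (map (segmentCount u v) S)) ×
          (∀ v → occurrences v (concat W) + occurrences v (concat W) ≡ sum (map (segmentWeight v) S))
closeSegments done [] refl = [] , (λ u v → refl) , λ v → refl
closeSegments (loop {x} e) ((_ , I , _) ∷ S) refl with closeSegments e S refl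
... | W , count , occ = (x ∷ I) ∷ W , (λ u v → cong₂ _+_ (cycleCount-∷ u v x I) (count u v)) , λ v → begin
    occurrences v ((x ∷ I) ++ concat W) + occurrences v ((x ∷ I) ++ concat W)
      ≡⟨ cong (λ k → k + k) (occurrences-++ v (x ∷ I) (concat W)) ⟩
    𝟙 (x == v) + occurrences v I + occurrences v (concat W) + (𝟙 (x == v) + occurrences v I + occurrences v (concat W))
      ≡⟨ regroup (𝟙 (x == v)) (occurrences v I) (occurrences v (concat W)) ⟩
    segmentWeight v (x , I , x) + (occurrences v (concat W) + occurrences v (concat W))
      ≡⟨ cong (segmentWeight v (x , I , x) +_) (occ v) ⟩
    sum (map (segmentWeight v) ((x , I , x) ∷ S)) ∎
  where
  open ≡-Reasoning
  regroup : ∀ a b c → a + b + c + (a + b + c) ≡ b + b + (a + a) + (c + c)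
  regroup = solve-∀
closeSegments (join {x} {y} {z} e) ((_ , I , _) ∷ (_ , J , _) ∷ S) refl
  with closeSegments e ((x , I ++ y ∷ J , z) ∷ S) refl
... | W , count , occ = W , (λ u v → ≡.trans (count u v) (edges u v)) , λ v → ≡.trans (occ v) (weights v)
  where
  edges : ∀ u v → segmentCount u v (x , I ++ y ∷ J , z) + sum (map (segmentCount u v) S) ≡
    segmentCount u v (x , I , y) + (segmentCount u v (y , J , z) + sum (map (segmentCount u v) S))
  edges u v rewrite ++-assoc I (y ∷ J) (z ∷ []) | pathCount-++ u v (x ∷ I) y (J ++ z ∷ []) =
    +-assoc (segmentCount u v (x , I , y)) _ _
  weights : ∀ v → segmentWeight v (x , I ++ y ∷ J , z) + sum (map (segmentWeight v) S) ≡
    segmentWeight v (x , I , y) + (segmentWeight v (y , J , z) + sum (map (segmentWeight v) S))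
  weights v rewrite occurrences-++ v I (y ∷ J) =
    regroup (occurrences v I) (𝟙 (y == v)) (occurrences v J) (𝟙 (x == v)) (𝟙 (z == v)) _
    where
    regroup : ∀ i y j x z s → i + (y + j) + (i + (y + j)) + (x + z) + s ≡ i + i + (x + y) + (j + j + (y + z) + s)
    regroup = solve-∀
closeSegments (flip {x} {y} e) ((_ , I , _) ∷ S) refl with closeSegments e ((x , reverse I , y) ∷ S) refl
... | W , count , occ = W ,
    (λ u v → ≡.trans (count u v) (cong (_+ sum (map (segmentCount u v) S)) (edges u v))) ,
    λ v → ≡.trans (occ v) (cong (_+ sum (map (segmentWeight v) S))
      (cong₂ _+_ (cong (λ k → k + k) (occurrences-reverse v I)) (+-comm (𝟙 (x == v)) _)))
  where
  edges : ∀ u v → segmentCount u v (x , reverse I , y) ≡ segmentCount u v (y , I , x)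
  edges u v = ≡.trans (cong (pathCount u v) (sym flipped)) (pathCount-reverse u v (y ∷ I ++ x ∷ []))
    where
    flipped : reverse (y ∷ I ++ x ∷ []) ≡ x ∷ reverse I ++ y ∷ []
    flipped = ≡.trans (unfold-reverse y (I ++ x ∷ [])) (cong (_∷ʳ y) (reverse-++ I (x ∷ [])))
closeSegments (perm r e) S refl with ↭-map-inv ends (↭-sym r)
... | S' , refl , r' with closeSegments e S' refl
...   | W , count , occ = W , (λ u v → ≡.trans (count u v) (sum-↭ (map⁺ _ (↭-sym r')))) ,
                              λ v → ≡.trans (occ v) (sum-↭ (map⁺ _ (↭-sym r')))

-- Every edge starts as a path without interior. The trails may repeat vertices in general; in
-- `liftColour` all degrees are 0 or 2, and the second equation then makes every vertex occur at
-- most once.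
closedTrails : (E : List (Fin N × Fin N)) → (∀ v → Even (incidences v E)) →
  ∃ λ W → (∀ u v → cyclesCount u v W ≡ countEdge u v E) ×
          (∀ v → occurrences v (concat W) + occurrences v (concat W) ≡ incidences v E)
closedTrails E ev with closeSegments (even⇒Eulerian _ E refl ev) (map edge E) (ends-edge E)
  where
  edge : Fin N × Fin N → Segment N
  edge (a , b) = a , [] , b
  ends-edge : ∀ E → map ends (map edge E) ≡ E
  ends-edge [] = refl
  ends-edge (e ∷ E) = cong (e ∷_) (ends-edge E)
... | W , count , occ = W , (λ u v → ≡.trans (count u v) (counts u v E)) , λ v → ≡.trans (occ v) (weights v E)
  where
  counts : ∀ u v E → sum (map (segmentCount u v) (map (λ (a , b) → a , [] , b) E)) ≡ countEdge u v E
  counts u v [] = refl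
  counts u v (e ∷ E) = cong₂ _+_ (+-identityʳ (𝟙 (isEdge u v e))) (counts u v E)
  weights : ∀ v E → sum (map (segmentWeight v) (map (λ (a , b) → a , [] , b) E)) ≡ incidences v E
  weights v [] = refl
  weights v ((a , b) ∷ E) = cong (𝟙 (a == v) + 𝟙 (b == v) +_) (weights v E)

-- Re-splitting two vertices

Joined : List (List (Fin N)) → Fin N → Fin N → Set
Joined W x y = Any (λ C → 1 ≤ occurrences x C × 1 ≤ occurrences y C) W

-- The effect of re-splitting the vertices p and q on one colour: each arc records the two neighbours
-- that end up at p and q, and any orientation of the arcs (tail at p, head at q) can be realised.
record Switch {N : ℕ} (p q : Fin N) (g : Mult N) (S : Set) (g' : S → Mult N) : Set where
  field
    arcs : List (Fin N × Fin N)
    avoids-p : incidences p arcs ≡ 0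
    avoids-q : incidences q arcs ≡ 0
    neighbours : ∀ w → w ≢ p → w ≢ q → g p w + g q w ≡ incidences w arcs
    realize : ∀ M → Pointwise Orients arcs M → Σ S λ s →
      (∀ w → g' s p w ≡ outdegree w M) ×
      (∀ w → g' s q w ≡ indegree w M) ×
      (∀ x y → x ≢ p → x ≢ q → y ≢ p → y ≢ q → g' s x y ≡ g x y)

split-at : (p : Fin N) (C : List (Fin N)) → occurrences p C ≢ 0 → ∃₂ λ xs ys → C ≡ xs ++ p ∷ ys
split-at p [] ne = contradiction refl ne
split-at p (x ∷ C) ne with x Fin.≟ p
... | yes refl = [] , C , refl
... | no _ with split-at p C ne
...   | xs , ys , refl = x ∷ xs , ys , refl

cycleCount-rotate : (u v p : Fin N) (xs ys : List (Fin N)) →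
  cycleCount u v (xs ++ p ∷ ys) ≡ cycleCount u v (p ∷ ys ++ xs)
cycleCount-rotate u v p [] ys = cong (λ zs → cycleCount u v (p ∷ zs)) (sym (++-identityʳ ys))
cycleCount-rotate u v p (x ∷ xs) ys = begin
  cycleCount u v (x ∷ xs ++ p ∷ ys)
    ≡⟨ cycleCount-∷ u v x (xs ++ p ∷ ys) ⟩
  pathCount u v (x ∷ (xs ++ p ∷ ys) ++ x ∷ [])
    ≡⟨ cong (λ zs → pathCount u v (x ∷ zs)) (++-assoc xs (p ∷ ys) (x ∷ [])) ⟩
  pathCount u v (x ∷ xs ++ p ∷ ys ++ x ∷ [])
    ≡⟨ pathCount-++ u v (x ∷ xs) p (ys ++ x ∷ []) ⟩
  pathCount u v (x ∷ xs ++ p ∷ []) + pathCount u v (p ∷ ys ++ x ∷ [])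
    ≡⟨ +-comm (pathCount u v (x ∷ xs ++ p ∷ [])) _ ⟩
  pathCount u v (p ∷ ys ++ x ∷ []) + pathCount u v (x ∷ xs ++ p ∷ [])
    ≡⟨ pathCount-++ u v (p ∷ ys) x (xs ++ p ∷ []) ⟨
  pathCount u v (p ∷ ys ++ x ∷ xs ++ p ∷ [])
    ≡⟨ cong (λ zs → pathCount u v (p ∷ zs)) (++-assoc ys (x ∷ xs) (p ∷ [])) ⟨
  pathCount u v (p ∷ (ys ++ x ∷ xs) ++ p ∷ [])
    ≡⟨ cycleCount-∷ u v p (ys ++ x ∷ xs) ⟨
  cycleCount u v (p ∷ ys ++ x ∷ xs) ∎
  where open ≡-Reasoning

-- `joins` runs in one direction: what is carried along is that vertices once on a common trail stay
-- together.
record _⊑_ {N : ℕ} (W W' : List (List (Fin N))) : Set where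
  field
    counts : ∀ u v → cyclesCount u v W ≡ cyclesCount u v W'
    occs : ∀ v → occurrences v (concat W) ≡ occurrences v (concat W')
    joins : ∀ x y → Joined W x y → Joined W' x y
open _⊑_ public

isolate : (p : Fin N) (W : List (List (Fin N))) → occurrences p (concat W) ≢ 0 →
  ∃₂ λ C W' → W ⊑ ((p ∷ C) ∷ W')
isolate p [] ne = contradiction refl ne
isolate p (C ∷ W) ne with occurrences p C in eq
... | suc _ with split-at p C (λ z → contradiction (≡.trans (sym eq) z) λ ())
...   | xs , ys , refl = ys ++ xs , W , record
        { counts = λ u v → cong (_+ cyclesCount u v W) (cycleCount-rotate u v p xs ys)
        ; occs = λ v → ≡.trans (occurrences-++ v (xs ++ p ∷ ys) (concat W))
            (≡.trans (cong (_+ occurrences v (concat W)) (rotate v)) (sym (occurrences-++ v (p ∷ ys ++ xs) (concat W))))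
        ; joins = λ where
            x y (here (x∈ , y∈)) → here (subst (1 ≤_) (rotate x) x∈ , subst (1 ≤_) (rotate y) y∈)
            x y (there j) → there j
        }
  where
  rotate : ∀ v → occurrences v (xs ++ p ∷ ys) ≡ occurrences v (p ∷ ys ++ xs)
  rotate v = ≡.trans (occurrences-++ v xs (p ∷ ys))
    (≡.trans (+-comm (occurrences v xs) _) (sym (occurrences-++ v (p ∷ ys) xs)))
isolate p (C ∷ W) ne | zero
  with isolate p W (λ z → ne (≡.trans (occurrences-++ p C (concat W)) (cong₂ _+_ eq z)))
... | D , W' , W⊑ = D , C ∷ W' , record
        { counts = λ u v → ≡.trans (cong (cycleCount u v C +_) (counts W⊑ u v))
            (exchange (cycleCount u v C) (cycleCount u v (p ∷ D)) (cyclesCount u v W'))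
        ; occs = occs'
        ; joins = λ where
            x y (here j) → there (here j)
            x y (there j) → case joins W⊑ x y j of λ where
              (here j) → here j
              (there j) → there (there j)
        }
  where
  open ≡-Reasoning
  occs' : ∀ v → occurrences v (C ++ concat W) ≡ occurrences v ((p ∷ D) ++ (C ++ concat W'))
  occs' v = begin
    occurrences v (C ++ concat W)
      ≡⟨ occurrences-++ v C (concat W) ⟩
    occurrences v C + occurrences v (concat W)
      ≡⟨ cong (occurrences v C +_) (≡.trans (occs W⊑ v) (occurrences-++ v (p ∷ D) (concat W'))) ⟩
    occurrences v C + (occurrences v (p ∷ D) + occurrences v (concat W'))
      ≡⟨ exchange (occurrences v C) (occurrences v (p ∷ D)) _ ⟩
    occurrences v (p ∷ D) + (occurrences v C + occurrences v (concat W'))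
      ≡⟨ cong (occurrences v (p ∷ D) +_) (occurrences-++ v C (concat W')) ⟨
    occurrences v (p ∷ D) + occurrences v (C ++ concat W')
      ≡⟨ occurrences-++ v (p ∷ D) (C ++ concat W') ⟨
    occurrences v ((p ∷ D) ++ (C ++ concat W')) ∎

𝟙≡0⇒false : ∀ b → 𝟙 b ≡ 0 → b ≡ false
𝟙≡0⇒false false _ = refl

absent-∷ : (r x : Fin N) (L : List (Fin N)) → occurrences r (x ∷ L) ≡ 0 →
  (x == r) ≡ false × occurrences r L ≡ 0
absent-∷ r x L z = 𝟙≡0⇒false _ (m+n≡0⇒m≡0 _ z) , m+n≡0⇒n≡0 (𝟙 (x == r)) z

pathCount-absent : (r w : Fin N) (L : List (Fin N)) → occurrences r L ≡ 0 → pathCount r w L ≡ 0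
pathCount-absent r w [] z = refl
pathCount-absent r w (x ∷ []) z = refl
pathCount-absent r w (x ∷ y ∷ L) z = cong₂ _+_ (cong 𝟙 edge) (pathCount-absent r w (y ∷ L) (proj₂ tail))
  where
  tail = absent-∷ r x (y ∷ L) z
  edge : isEdge r w (x , y) ≡ false
  edge rewrite proj₁ tail | proj₁ (absent-∷ r y L (proj₂ tail)) = ∧-zeroʳ (x == w)

cycleCount-absent : (r w : Fin N) (C : List (Fin N)) → occurrences r C ≡ 0 → cycleCount r w C ≡ 0
cycleCount-absent r w [] z = refl
cycleCount-absent r w (x ∷ xs) z = ≡.trans (cycleCount-∷ r w x xs) (pathCount-absent r w (x ∷ xs ++ x ∷ []) absent)
  where
  absent : occurrences r (x ∷ xs ++ x ∷ []) ≡ 0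
  absent rewrite occurrences-++ r (x ∷ xs) (x ∷ []) | z | proj₁ (absent-∷ r x xs z) = refl

cyclesCount-absent : (r w : Fin N) (W : List (List (Fin N))) → occurrences r (concat W) ≡ 0 → cyclesCount r w W ≡ 0
cyclesCount-absent r w [] z = refl
cyclesCount-absent r w (C ∷ W) z = cong₂ _+_
  (cycleCount-absent r w C (m+n≡0⇒m≡0 _ z'))
  (cyclesCount-absent r w W (m+n≡0⇒n≡0 (occurrences r C) z'))
  where
  z' = ≡.trans (sym (occurrences-++ r C (concat W))) z

record Ends {N : ℕ} (L : List (Fin N)) (x y : Fin N) : Set where
  field
    rest front : List (Fin N)
    first : L ≡ x ∷ rest
    last : L ≡ front ∷ʳ y

Ends-nonempty : (x : Fin N) (L : List (Fin N)) → ∃ λ y → Ends (x ∷ L) x y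
Ends-nonempty x [] = x , record { rest = [] ; front = [] ; first = refl ; last = refl }
Ends-nonempty x (y ∷ L) with Ends-nonempty y L
... | z , e = z , record { rest = y ∷ L ; front = x ∷ Ends.front e ; first = refl ; last = cong (x ∷_) (Ends.last e) }

Ends-reverse : {L : List (Fin N)} {x y : Fin N} → Ends L x y → Ends (reverse L) y x
Ends-reverse {L = L} {x} {y} e = record
  { rest = reverse front ; front = reverse rest
  ; first = ≡.trans (cong reverse last) (reverse-++ front (y ∷ []))
  ; last = ≡.trans (cong reverse first) (unfold-reverse x rest) }
  where open Ends e

pathCount-ends : (u v s t : Fin N) {L : List (Fin N)} {x y : Fin N} → Ends L x y →
  pathCount u v (s ∷ L ++ t ∷ []) ≡ 𝟙 (isEdge u v (s , x)) + (pathCount u v L + 𝟙 (isEdge u v (y , t)))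
pathCount-ends u v s t {L} {x} {y} e = begin
  pathCount u v (s ∷ L ++ t ∷ [])
    ≡⟨ cong (λ zs → pathCount u v (s ∷ zs ++ t ∷ [])) first ⟩
  𝟙 (isEdge u v (s , x)) + pathCount u v ((x ∷ rest) ++ t ∷ [])
    ≡⟨ cong (λ zs → 𝟙 (isEdge u v (s , x)) + pathCount u v (zs ++ t ∷ [])) (≡.trans (sym first) last) ⟩
  𝟙 (isEdge u v (s , x)) + pathCount u v ((front ∷ʳ y) ++ t ∷ [])
    ≡⟨ cong (λ zs → 𝟙 (isEdge u v (s , x)) + pathCount u v zs) (++-assoc front (y ∷ []) (t ∷ [])) ⟩
  𝟙 (isEdge u v (s , x)) + pathCount u v (front ++ y ∷ t ∷ [])
    ≡⟨ cong (𝟙 (isEdge u v (s , x)) +_) (pathCount-++ u v front y (t ∷ [])) ⟩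
  𝟙 (isEdge u v (s , x)) + (pathCount u v (front ∷ʳ y) + (𝟙 (isEdge u v (y , t)) + 0))
    ≡⟨ cong (𝟙 (isEdge u v (s , x)) +_) (cong₂ _+_ (cong (pathCount u v) (sym last)) (+-identityʳ _)) ⟩
  𝟙 (isEdge u v (s , x)) + (pathCount u v L + 𝟙 (isEdge u v (y , t))) ∎
  where
  open ≡-Reasoning
  open Ends e

Ends-absent : {r : Fin N} {L : List (Fin N)} {x y : Fin N} → Ends L x y → occurrences r L ≡ 0 →
  (x == r) ≡ false × (y == r) ≡ false
Ends-absent {r = r} {L} {x} {y} e z =
  proj₁ (absent-∷ r x (Ends.rest e) (subst (λ l → occurrences r l ≡ 0) (Ends.first e) z)) ,
  𝟙≡0⇒false _ (≡.trans (sym (+-identityʳ _)) (m+n≡0⇒n≡0 (occurrences r (Ends.front e))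
    (≡.trans (sym (occurrences-++ r (Ends.front e) (y ∷ []))) (subst (λ l → occurrences r l ≡ 0) (Ends.last e) z))))

module _ {L : List (Fin N)} {x y : Fin N} (e : Ends L x y) where

  -- If r avoids L, only the two outer edges can meet r, and only through s or t. What remains lists
  -- the neighbours of r.
  loopCount-absent : ∀ r w s t → occurrences r L ≡ 0 →
    pathCount r w (s ∷ L ++ t ∷ []) ≡ 𝟙 ((s == r) ∧ (x == w)) + 𝟙 ((t == r) ∧ (y == w))
  loopCount-absent r w s t z with Ends-absent e z
  ... | x≠r , y≠r = ≡.trans (pathCount-ends r w s t e)
    (cong₂ _+_ (cong 𝟙 left) (cong₂ _+_ (pathCount-absent r w L z) (cong 𝟙 right)))
    where
    left : isEdge r w (s , x) ≡ (s == r) ∧ (x == w)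
    left rewrite x≠r | ∧-zeroʳ (s == w) = ∨-identityʳ _
    right : isEdge r w (y , t) ≡ (t == r) ∧ (y == w)
    right rewrite y≠r = ∧-comm (y == w) _

  loopCount-away : ∀ a b s t → s ≢ a → s ≢ b → t ≢ a → t ≢ b →
    pathCount a b (s ∷ L ++ t ∷ []) ≡ pathCount a b L
  loopCount-away a b s t sa sb ta tb = ≡.trans (pathCount-ends a b s t e) (≡.trans (cong₂ _+_ (cong 𝟙 left) (cong (pathCount a b L +_) (cong 𝟙 right))) (+-identityʳ _))
    where
    left : isEdge a b (s , x) ≡ false
    left rewrite ==-≢ sa | ==-≢ sb = refl
    right : isEdge a b (y , t) ≡ false
    right rewrite ==-≢ ta | ==-≢ tb | ∧-zeroʳ (y == a) | ∧-zeroʳ (y == b) = refl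

  -- Adding the counts at p and q amalgamates the two vertices: the sum sees the end vertices x and
  -- y of the loop, but not to which of p and q they are attached.
  loopCount-both : ∀ {p q} w {s t} → p ≢ q → s ≡ p ⊎ s ≡ q → t ≡ p ⊎ t ≡ q →
    occurrences p L ≡ 0 → occurrences q L ≡ 0 →
    pathCount p w (s ∷ L ++ t ∷ []) + pathCount q w (s ∷ L ++ t ∷ []) ≡ 𝟙 (x == w) + 𝟙 (y == w)
  loopCount-both {p} {q} w {s} {t} p≢q s∈ t∈ zp zq
    rewrite loopCount-absent p w s t zp | loopCount-absent q w s t zq
    = ≡.trans (regroup (𝟙 ((s == p) ∧ (x == w))) (𝟙 ((t == p) ∧ (y == w))) _ _) (cong₂ _+_ (one-side s∈ (x == w)) (one-side t∈ (y == w)))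
    where
    regroup : ∀ a b c d → a + b + (c + d) ≡ a + c + (b + d)
    regroup = solve-∀
    one-side : ∀ {s} → s ≡ p ⊎ s ≡ q → ∀ b → 𝟙 ((s == p) ∧ b) + 𝟙 ((s == q) ∧ b) ≡ 𝟙 b
    one-side (inj₁ refl) b rewrite ==-≡ {a = p} refl | ==-≢ p≢q = +-identityʳ _
    one-side (inj₂ refl) b rewrite ==-≡ {a = q} refl | ==-≢ (p≢q ∘ sym) = refl

  -- Turning an arc means traversing its loop backwards, which changes neither its edges nor its
  -- vertices.
  reorient : ∀ {b₁ b₂} → Orients (x , y) (b₁ , b₂) → ∃ λ L' → Ends L' b₁ b₂ ×
    (∀ u v → pathCount u v L' ≡ pathCount u v L) × (∀ v → occurrences v L' ≡ occurrences v L)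
  reorient keep = L , e , (λ u v → refl) , λ v → refl
  reorient turn = reverse L , Ends-reverse e , (λ u v → pathCount-reverse u v L) , λ v → occurrences-reverse v L

-- The colour seen with p and q merged: two loops with interiors A and B, and the trails R
-- elsewhere. The ends s, t, s', t' remember how W splits them: p A q and q B p if p and q share a
-- trail, p A p and q B q otherwise. In both cases the fused trail in `loop-joins` keeps joined
-- pairs joined.
record Loops {N : ℕ} (p q : Fin N) (W : List (List (Fin N))) : Set where
  field
    A B : List (Fin N)
    R : List (List (Fin N))
    s t s' t' : Fin N
    s∈ : s ≡ p ⊎ s ≡ q
    t∈ : t ≡ p ⊎ t ≡ q
    s'∈ : s' ≡ p ⊎ s' ≡ q
    t'∈ : t' ≡ p ⊎ t' ≡ q
    loop-counts : ∀ u v → cyclesCount u v W ≡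
      pathCount u v (s ∷ A ++ t ∷ []) + (pathCount u v (s' ∷ B ++ t' ∷ []) + cyclesCount u v R)
    loop-occs : ∀ v → occurrences v (concat W) ≡
      occurrences v (p ∷ A) + (occurrences v (q ∷ B) + occurrences v (concat R))
    loop-joins : ∀ x y → Joined W x y → Joined ((p ∷ A ++ q ∷ B) ∷ R) x y

cycleCount-two : (u v p q : Fin N) (A B : List (Fin N)) → cycleCount u v (p ∷ A ++ q ∷ B) ≡
  pathCount u v (p ∷ A ++ q ∷ []) + pathCount u v (q ∷ B ++ p ∷ [])
cycleCount-two u v p q A B = ≡.trans (cycleCount-∷ u v p (A ++ q ∷ B))
  (≡.trans (cong (λ zs → pathCount u v (p ∷ zs)) (++-assoc A (q ∷ B) (p ∷ [])))
    (pathCount-++ u v (p ∷ A) q (B ++ p ∷ [])))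

≡1⇒≢0 : ∀ {k} → k ≡ 1 → k ≢ 0
≡1⇒≢0 refl ()

loops : (p q : Fin N) (W : List (List (Fin N))) → p ≢ q →
  occurrences p (concat W) ≡ 1 → occurrences q (concat W) ≡ 1 → Loops p q W
loops p q W p≢q p₁ q₁ with isolate p W (≡1⇒≢0 p₁)
... | C , W' , W⊑ with occurrences q C in eq
...   | suc _ with split-at q C (λ z → contradiction (≡.trans (sym eq) z) λ ())
...     | A , B , refl = record
          { A = A ; B = B ; R = W' ; s = p ; t = q ; s' = q ; t' = p
          ; s∈ = inj₁ refl ; t∈ = inj₂ refl ; s'∈ = inj₂ refl ; t'∈ = inj₁ refl
          ; loop-counts = λ u v → ≡.trans (counts W⊑ u v)
              (≡.trans (cong (_+ cyclesCount u v W') (cycleCount-two u v p q A B))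
                (+-assoc (pathCount u v (p ∷ A ++ q ∷ [])) _ _))
          ; loop-occs = λ v → ≡.trans (occs W⊑ v)
              (≡.trans (occurrences-++ v (p ∷ A ++ q ∷ B) (concat W'))
                (≡.trans (cong (_+ occurrences v (concat W')) (occurrences-++ v (p ∷ A) (q ∷ B)))
                  (+-assoc (occurrences v (p ∷ A)) _ _)))
          ; loop-joins = joins W⊑
          }
loops p q W p≢q p₁ q₁ | C , W' , W⊑ | zero with isolate q W' (≡1⇒≢0 (≡.trans (sym elsewhere) q₁))
  where
  elsewhere : occurrences q (concat W) ≡ occurrences q (concat W')
  elsewhere = ≡.trans (occs W⊑ q) (≡.trans (occurrences-++ q (p ∷ C) (concat W'))
    (cong (_+ occurrences q (concat W')) (cong₂ _+_ (cong 𝟙 (==-≢ p≢q)) eq)))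
... | D , R , W'⊑ = record
          { A = C ; B = D ; R = R ; s = p ; t = p ; s' = q ; t' = q
          ; s∈ = inj₁ refl ; t∈ = inj₁ refl ; s'∈ = inj₂ refl ; t'∈ = inj₂ refl
          ; loop-counts = λ u v → ≡.trans (counts W⊑ u v)
              (cong₂ _+_ (cycleCount-∷ u v p C)
                (≡.trans (counts W'⊑ u v) (cong (_+ cyclesCount u v R) (cycleCount-∷ u v q D))))
          ; loop-occs = λ v → ≡.trans (occs W⊑ v)
              (≡.trans (occurrences-++ v (p ∷ C) (concat W'))
                (cong (occurrences v (p ∷ C) +_) (≡.trans (occs W'⊑ v) (occurrences-++ v (q ∷ D) (concat R)))))
          ; loop-joins = λ x y j → case joins W⊑ x y j of λ where
              (here (x∈ , y∈)) → here (left x x∈ , left y y∈)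
              (there j') → case joins W'⊑ x y j' of λ where
                (here (x∈ , y∈)) → here (right x x∈ , right y y∈)
                (there j'') → there j''
          }
  where
  left : ∀ v → 1 ≤ occurrences v (p ∷ C) → 1 ≤ occurrences v (p ∷ C ++ q ∷ D)
  left v h rewrite occurrences-++ v (p ∷ C) (q ∷ D) = ≤-trans h (m≤m+n _ _)
  right : ∀ v → 1 ≤ occurrences v (q ∷ D) → 1 ≤ occurrences v (p ∷ C ++ q ∷ D)
  right v h rewrite occurrences-++ v (p ∷ C) (q ∷ D) = ≤-trans h (m≤n+m _ (occurrences v (p ∷ C)))

record Rejoined {N : ℕ} (p q : Fin N) (W : List (List (Fin N))) : Set where
  field
    trails : List (List (Fin N))
    same-occs : ∀ v → occurrences v (concat trails) ≡ occurrences v (concat W)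
    same-joins : ∀ x y → Joined W x y → Joined trails x y
    new-join : Joined trails p q
open Rejoined public

-- Both loops are made to run from p to q, and the direction of an arc decides which end of its loop
-- is attached to p. The last hypothesis includes s = t, so it excludes loops at p and q as well as
-- edges between them.
switchTrails : (p q : Fin N) (W : List (List (Fin N))) → p ≢ q → Loops p q W →
  occurrences p (concat W) ≡ 1 → occurrences q (concat W) ≡ 1 →
  (∀ {s t} → s ≡ p ⊎ s ≡ q → t ≡ p ⊎ t ≡ q → cyclesCount s t W ≡ 0) →
  Switch p q (λ u v → cyclesCount u v W) (Rejoined p q W) (λ S u v → cyclesCount u v (trails S))
switchTrails {N} p q W p≢q split p₁ q₁ isolated = result
  where
  open Loops split

  -- The single occurrence of r is the p or q written in front of A or B, so none is left for A, B
  -- and R. The numbers b and c are the contributions of these two leading vertices.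
  vanish : ∀ r b c → b + c ≡ 1 → occurrences r (concat W) ≡ 1 →
    (∀ v → v ≡ r → 𝟙 (p == v) ≡ b × 𝟙 (q == v) ≡ c) →
    occurrences r A + (occurrences r B + occurrences r (concat R)) ≡ 0
  vanish r b c b+c≡1 r₁ bc = +-cancelˡ-≡ 1 _ _ (begin
    1 + (occurrences r A + (occurrences r B + occurrences r (concat R)))
      ≡⟨ cong (_+ (occurrences r A + (occurrences r B + occurrences r (concat R)))) b+c≡1 ⟨
    b + c + (occurrences r A + (occurrences r B + occurrences r (concat R)))
      ≡⟨ regroup b c (occurrences r A) (occurrences r B) (occurrences r (concat R)) ⟩
    b + occurrences r A + (c + occurrences r B + occurrences r (concat R))
      ≡⟨ cong₂ (λ b c → b + occurrences r A + (c + occurrences r B + occurrences r (concat R))) (proj₁ (bc r refl)) (proj₂ (bc r refl)) ⟨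
    occurrences r (p ∷ A) + (occurrences r (q ∷ B) + occurrences r (concat R))
      ≡⟨ loop-occs r ⟨
    occurrences r (concat W)
      ≡⟨ r₁ ⟩
    1 ∎)
    where
    open ≡-Reasoning
    regroup : ∀ b c x y z → b + c + (x + (y + z)) ≡ b + x + (c + y + z)
    regroup = solve-∀

  p₀ : occurrences p A + (occurrences p B + occurrences p (concat R)) ≡ 0
  p₀ = vanish p 1 0 refl p₁ λ { v refl → cong 𝟙 (==-≡ {a = p} refl) , cong 𝟙 (==-≢ (p≢q ∘ sym)) }
  q₀ : occurrences q A + (occurrences q B + occurrences q (concat R)) ≡ 0
  q₀ = vanish q 0 1 refl q₁ λ { v refl → cong 𝟙 (==-≢ p≢q) , cong 𝟙 (==-≡ {a = q} refl) }

  pA = m+n≡0⇒m≡0 _ p₀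
  pBR = m+n≡0⇒n≡0 (occurrences p A) p₀
  pB = m+n≡0⇒m≡0 _ pBR
  pR = m+n≡0⇒n≡0 (occurrences p B) pBR
  qA = m+n≡0⇒m≡0 _ q₀
  qBR = m+n≡0⇒n≡0 (occurrences q A) q₀
  qB = m+n≡0⇒m≡0 _ qBR
  qR = m+n≡0⇒n≡0 (occurrences q B) qBR

  -- A loop without interior would be an edge from s to t, hence inside {p , q}.
  ends-of : ∀ L {s t : Fin N} → pathCount s t (s ∷ L ++ t ∷ []) ≡ 0 → ∃₂ (Ends L)
  ends-of [] {s} {t} z = contradiction (subst (λ b → 𝟙 b ≡ 0) stays (m+n≡0⇒m≡0 _ z)) λ ()
    where
    stays : isEdge s t (s , t) ≡ true
    stays rewrite ==-≡ {a = s} refl | ==-≡ {a = t} refl = refl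
  ends-of (x ∷ L) _ with Ends-nonempty x L
  ... | y , e = x , y , e

  eA = ends-of A (m+n≡0⇒m≡0 _ (≡.trans (sym (loop-counts s t)) (isolated s∈ t∈)))
  eB = ends-of B (m+n≡0⇒m≡0 _ (m+n≡0⇒n≡0 (pathCount s' t' (s ∷ A ++ t ∷ []))
         (≡.trans (sym (loop-counts s' t')) (isolated s'∈ t'∈))))
  x = proj₁ eA
  y = proj₁ (proj₂ eA)
  x' = proj₁ eB
  y' = proj₁ (proj₂ eB)
  endsA = proj₂ (proj₂ eA)
  endsB = proj₂ (proj₂ eB)

  avoid : ∀ r → occurrences r A ≡ 0 → occurrences r B ≡ 0 → incidences r ((x , y) ∷ (x' , y') ∷ []) ≡ 0
  avoid r rA rB with Ends-absent endsA rA | Ends-absent endsB rB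
  ... | a , b | c , d rewrite a | b | c | d = refl

  nbrs : ∀ w → w ≢ p → w ≢ q →
    cyclesCount p w W + cyclesCount q w W ≡ incidences w ((x , y) ∷ (x' , y') ∷ [])
  nbrs w _ _ = begin
    cyclesCount p w W + cyclesCount q w W
      ≡⟨ cong₂ _+_ (loop-counts p w) (loop-counts q w) ⟩
    cA p + (cB p + cyclesCount p w R) + (cA q + (cB q + cyclesCount q w R))
      ≡⟨ regroup (cA p) (cB p) _ (cA q) (cB q) _ ⟩
    cA p + cA q + (cB p + cB q + (cyclesCount p w R + cyclesCount q w R))
      ≡⟨ cong₂ _+_ (loopCount-both endsA w p≢q s∈ t∈ pA qA)
           (cong₂ _+_ (loopCount-both endsB w p≢q s'∈ t'∈ pB qB)
             (cong₂ _+_ (cyclesCount-absent p w R pR) (cyclesCount-absent q w R qR))) ⟩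
    incidences w ((x , y) ∷ (x' , y') ∷ []) ∎
    where
    open ≡-Reasoning
    cA cB : Fin N → ℕ
    cA r = pathCount r w (s ∷ A ++ t ∷ [])
    cB r = pathCount r w (s' ∷ B ++ t' ∷ [])
    regroup : ∀ a b c d e f → a + (b + c) + (d + (e + f)) ≡ a + d + (b + e + (c + f))
    regroup = solve-∀

  realise : ∀ M → Pointwise Orients ((x , y) ∷ (x' , y') ∷ []) M → Σ (Rejoined p q W) λ S →
      (∀ w → cyclesCount p w (trails S) ≡ outdegree w M) ×
      (∀ w → cyclesCount q w (trails S) ≡ indegree w M) ×
      (∀ u v → u ≢ p → u ≢ q → v ≢ p → v ≢ q → cyclesCount u v (trails S) ≡ cyclesCount u v W)
  realise ((a₁ , a₂) ∷ (b₁ , b₂) ∷ []) (o ∷ o' ∷ [])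
    with reorient endsA o | reorient endsB o'
  ... | A' , endsA' , pathA' , occA' | B' , endsB' , pathB' , occB' =
    -- Both loops run from p to q, but the trail uses the second one to return to p, hence the
    -- reversal.
    record { trails = (p ∷ A' ++ q ∷ reverse B') ∷ R ; same-occs = occs' ; same-joins = joins'
           ; new-join = here (p∈ , q∈) }
    , at-p , at-q , away
    where
    open ≡-Reasoning
    new-occs : ∀ v → occurrences v (p ∷ A' ++ q ∷ reverse B') ≡ occurrences v (p ∷ A) + occurrences v (q ∷ B)
    new-occs v = ≡.trans (occurrences-++ v (p ∷ A') (q ∷ reverse B'))
      (cong₂ (λ i j → 𝟙 (p == v) + i + (𝟙 (q == v) + j)) (occA' v) (≡.trans (occurrences-reverse v B') (occB' v)))

    occs' : ∀ v → occurrences v (concat ((p ∷ A' ++ q ∷ reverse B') ∷ R)) ≡ occurrences v (concat W)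
    occs' v = begin
      occurrences v ((p ∷ A' ++ q ∷ reverse B') ++ concat R)
        ≡⟨ occurrences-++ v (p ∷ A' ++ q ∷ reverse B') (concat R) ⟩
      occurrences v (p ∷ A' ++ q ∷ reverse B') + occurrences v (concat R)
        ≡⟨ cong (_+ occurrences v (concat R)) (new-occs v) ⟩
      occurrences v (p ∷ A) + occurrences v (q ∷ B) + occurrences v (concat R)
        ≡⟨ +-assoc (occurrences v (p ∷ A)) _ _ ⟩
      occurrences v (p ∷ A) + (occurrences v (q ∷ B) + occurrences v (concat R))
        ≡⟨ loop-occs v ⟨
      occurrences v (concat W) ∎

    grow : ∀ v → occurrences v (p ∷ A ++ q ∷ B) ≡ occurrences v (p ∷ A' ++ q ∷ reverse B')
    grow v = ≡.trans (occurrences-++ v (p ∷ A) (q ∷ B)) (sym (new-occs v))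

    joins' : ∀ u v → Joined W u v → Joined ((p ∷ A' ++ q ∷ reverse B') ∷ R) u v
    joins' u v j with loop-joins u v j
    ... | here (u∈ , v∈) = here (subst (1 ≤_) (grow u) u∈ , subst (1 ≤_) (grow v) v∈)
    ... | there j' = there j'

    p∈ : 1 ≤ occurrences p (p ∷ A' ++ q ∷ reverse B')
    p∈ rewrite ==-≡ {a = p} refl = s≤s z≤n

    q∈ : 1 ≤ occurrences q (p ∷ A' ++ q ∷ reverse B')
    q∈ rewrite new-occs q | ==-≡ {a = q} refl = ≤-trans (s≤s z≤n) (m≤n+m _ (𝟙 (p == q) + occurrences q A))

    new-counts : ∀ u v → cyclesCount u v ((p ∷ A' ++ q ∷ reverse B') ∷ R) ≡
      pathCount u v (p ∷ A' ++ q ∷ []) + (pathCount u v (p ∷ B' ++ q ∷ []) + cyclesCount u v R)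
    new-counts u v = begin
      cycleCount u v (p ∷ A' ++ q ∷ reverse B') + cyclesCount u v R
        ≡⟨ cong (_+ cyclesCount u v R) (cycleCount-two u v p q A' (reverse B')) ⟩
      pathCount u v (p ∷ A' ++ q ∷ []) + pathCount u v (q ∷ reverse B' ++ p ∷ []) + cyclesCount u v R
        ≡⟨ cong (λ zs → pathCount u v (p ∷ A' ++ q ∷ []) + pathCount u v zs + cyclesCount u v R) reversed ⟨
      pathCount u v (p ∷ A' ++ q ∷ []) + pathCount u v (reverse (p ∷ B' ++ q ∷ [])) + cyclesCount u v R
        ≡⟨ cong (λ k → pathCount u v (p ∷ A' ++ q ∷ []) + k + cyclesCount u v R) (pathCount-reverse u v (p ∷ B' ++ q ∷ [])) ⟩
      pathCount u v (p ∷ A' ++ q ∷ []) + pathCount u v (p ∷ B' ++ q ∷ []) + cyclesCount u v R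
        ≡⟨ +-assoc (pathCount u v (p ∷ A' ++ q ∷ [])) _ _ ⟩
      pathCount u v (p ∷ A' ++ q ∷ []) + (pathCount u v (p ∷ B' ++ q ∷ []) + cyclesCount u v R) ∎
      where
      reversed : reverse (p ∷ B' ++ q ∷ []) ≡ q ∷ reverse B' ++ p ∷ []
      reversed = ≡.trans (unfold-reverse p (B' ++ q ∷ [])) (cong (_∷ʳ p) (reverse-++ B' (q ∷ [])))

    at-p : ∀ w → cyclesCount p w ((p ∷ A' ++ q ∷ reverse B') ∷ R) ≡ outdegree w ((a₁ , a₂) ∷ (b₁ , b₂) ∷ [])
    at-p w
      rewrite new-counts p w
            | loopCount-absent endsA' p w p q (≡.trans (occA' p) pA)
            | loopCount-absent endsB' p w p q (≡.trans (occB' p) pB)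
            | cyclesCount-absent p w R pR
            | ==-≡ {a = p} refl | ==-≢ (p≢q ∘ sym)
            | +-identityʳ (𝟙 (a₁ == w)) = cong (𝟙 (a₁ == w) +_) (+-identityʳ _)

    at-q : ∀ w → cyclesCount q w ((p ∷ A' ++ q ∷ reverse B') ∷ R) ≡ indegree w ((a₁ , a₂) ∷ (b₁ , b₂) ∷ [])
    at-q w
      rewrite new-counts q w
            | loopCount-absent endsA' q w p q (≡.trans (occA' q) qA)
            | loopCount-absent endsB' q w p q (≡.trans (occB' q) qB)
            | cyclesCount-absent q w R qR
            | ==-≡ {a = q} refl | ==-≢ p≢q = refl

    off : ∀ {u s} → u ≢ p → u ≢ q → s ≡ p ⊎ s ≡ q → s ≢ u
    off u≢p u≢q (inj₁ refl) = u≢p ∘ sym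
    off u≢p u≢q (inj₂ refl) = u≢q ∘ sym

    away : ∀ u v → u ≢ p → u ≢ q → v ≢ p → v ≢ q →
      cyclesCount u v ((p ∷ A' ++ q ∷ reverse B') ∷ R) ≡ cyclesCount u v W
    away u v up uq vp vq = ≡.trans (new-counts u v) (≡.trans
      (cong₂ (λ i j → i + (j + cyclesCount u v R))
        (≡.trans (loopCount-away endsA' u v p q (up ∘ sym) (vp ∘ sym) (uq ∘ sym) (vq ∘ sym))
          (≡.trans (pathA' u v) (sym (loopCount-away endsA u v s t (off up uq s∈) (off vp vq s∈) (off up uq t∈) (off vp vq t∈)))))
        (≡.trans (loopCount-away endsB' u v p q (up ∘ sym) (vp ∘ sym) (uq ∘ sym) (vq ∘ sym))
          (≡.trans (pathB' u v) (sym (loopCount-away endsB u v s' t' (off up uq s'∈) (off vp vq s'∈) (off up uq t'∈) (off vp vq t'∈))))))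
      (sym (loop-counts u v)))

  result : Switch p q (λ u v → cyclesCount u v W) (Rejoined p q W) (λ S u v → cyclesCount u v (trails S))
  result = record
    { arcs = (x , y) ∷ (x' , y') ∷ []
    ; avoids-p = avoid p pA pB
    ; avoids-q = avoid q qA qB
    ; neighbours = nbrs
    ; realize = realise
    }

-- Re-splitting the 1-factor, and all colours at once

countEdge-absent : (r w : Fin N) (E : List (Fin N × Fin N)) → incidences r E ≡ 0 → countEdge r w E ≡ 0
countEdge-absent r w [] z = refl
countEdge-absent r w ((a , b) ∷ E) z = cong₂ _+_ (cong 𝟙 edge) (countEdge-absent r w E (m+n≡0⇒n≡0 (𝟙 (a == r) + 𝟙 (b == r)) z))
  where
  at-head = m+n≡0⇒m≡0 _ z
  edge : isEdge r w (a , b) ≡ false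
  edge rewrite 𝟙≡0⇒false (a == r) (m+n≡0⇒m≡0 _ at-head) | 𝟙≡0⇒false (b == r) (m+n≡0⇒n≡0 (𝟙 (a == r)) at-head) = ∧-zeroʳ (a == w)

extract-oriented : (y : Fin N) (E : List (Fin N × Fin N)) → incidences y E ≢ 0 → ∃₂ λ z E' →
  (∀ v → incidences v E ≡ incidences v ((y , z) ∷ E')) × (∀ u v → countEdge u v E ≡ countEdge u v ((y , z) ∷ E'))
extract-oriented y E ne with extract y E ne
... | z , E' , inj₁ r = z , E' , (λ v → incidences-↭ v r) , λ u v → countWhere-↭ (isEdge u v) r
... | z , E' , inj₂ r = z , E' ,
  (λ v → ≡.trans (incidences-↭ v r) (cong (_+ incidences v E') (+-comm (𝟙 (z == v)) _))) ,
  λ u v → ≡.trans (countWhere-↭ (isEdge u v) r) (cong (λ b → 𝟙 b + countEdge u v E') (isEdge-flip u v y z))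

-- `P` stands for the odd-degree condition attached to a 1-factor. It concerns the whole multigraph,
-- so it passes through every switch unchanged.
FactorState : ℕ → Set → Set
FactorState N P = Σ (List (Fin N × Fin N)) λ F → F ≡ [] ⊎ (P × IsOneFactor F)

factorCount : {P : Set} → FactorState N P → Mult N
factorCount s u v = countEdge u v (proj₁ s)

-- If p x and q y are factor edges, the single arc (x , y) offers the choice between keeping and
-- exchanging the partners of p and q. Since p q is no factor edge, x and y lie outside {p , q}. An
-- empty factor offers no arc.
switchFactor : {P : Set} (p q : Fin N) → p ≢ q → (s : FactorState N P) → factorCount s p q ≡ 0 →
  Switch p q (factorCount s) (FactorState N P) factorCount
switchFactor p q p≢q s@(_ , inj₁ refl) _ = record
  { arcs = [] ; avoids-p = refl ; avoids-q = refl ; neighbours = λ _ _ _ → refl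
  ; realize = λ { [] [] → s , (λ _ → refl) , (λ _ → refl) , λ _ _ _ _ _ _ → refl } }
switchFactor {N} {P} p q p≢q (F , inj₂ (prop , once)) apart
  with extract-oriented p F (≡1⇒≢0 (once p))
... | x , F₁ , inc₁ , count₁ with x Fin.≟ q
...   | yes refl = contradiction (≡.trans (sym (count₁ p q)) apart) edge
  where
  edge : countEdge p q ((p , q) ∷ F₁) ≢ 0
  edge rewrite ==-≡ {a = p} refl | ==-≡ {a = q} refl = λ ()
...   | no x≢q with extract-oriented q F₁ (≡1⇒≢0 (≡.trans q-in-F₁ (once q)))
  where
  q-in-F₁ : incidences q F₁ ≡ incidences q F
  q-in-F₁ rewrite inc₁ q | ==-≢ p≢q | ==-≢ x≢q = refl
...     | y , F₂ , inc₂ , count₂ = record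
  { arcs = (x , y) ∷ [] ; avoids-p = avoid p xp yp ; avoids-q = avoid q (==-≢ x≢q) yq ; neighbours = nbrs ; realize = realise }
  where
  inc : ∀ v → incidences v F ≡ incidences v ((p , x) ∷ (q , y) ∷ F₂)
  inc v = ≡.trans (inc₁ v) (cong (𝟙 (p == v) + 𝟙 (x == v) +_) (inc₂ v))

  count : ∀ u v → countEdge u v F ≡ countEdge u v ((p , x) ∷ (q , y) ∷ F₂)
  count u v = ≡.trans (count₁ u v) (cong (𝟙 (isEdge u v (p , x)) +_) (count₂ u v))

  at-p : 𝟙 (x == p) + (𝟙 (y == p) + incidences p F₂) ≡ 0
  at-p = suc-injective (≡.trans (sym unfolded) (once p))
    where
    unfolded : incidences p F ≡ suc (𝟙 (x == p) + (𝟙 (y == p) + incidences p F₂))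
    unfolded rewrite inc p | ==-≡ {a = p} refl | ==-≢ (p≢q ∘ sym) = refl

  at-q : 𝟙 (y == q) + incidences q F₂ ≡ 0
  at-q = suc-injective (≡.trans (sym unfolded) (once q))
    where
    unfolded : incidences q F ≡ suc (𝟙 (y == q) + incidences q F₂)
    unfolded rewrite inc q | ==-≡ {a = q} refl | ==-≢ p≢q | ==-≢ x≢q = refl

  xp = 𝟙≡0⇒false (x == p) (m+n≡0⇒m≡0 _ at-p)
  yp = 𝟙≡0⇒false (y == p) (m+n≡0⇒m≡0 _ (m+n≡0⇒n≡0 (𝟙 (x == p)) at-p))
  pF₂ = m+n≡0⇒n≡0 (𝟙 (y == p)) (m+n≡0⇒n≡0 (𝟙 (x == p)) at-p)
  yq = 𝟙≡0⇒false (y == q) (m+n≡0⇒m≡0 _ at-q)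
  qF₂ = m+n≡0⇒n≡0 (𝟙 (y == q)) at-q

  avoid : ∀ r → (x == r) ≡ false → (y == r) ≡ false → incidences r ((x , y) ∷ []) ≡ 0
  avoid r a b rewrite a | b = refl

  p-count : ∀ b₁ b₂ w → (b₁ == p) ≡ false → (b₂ == p) ≡ false →
    countEdge p w ((p , b₁) ∷ (q , b₂) ∷ F₂) ≡ 𝟙 (b₁ == w) + 0
  p-count b₁ b₂ w z₁ z₂ rewrite z₁ | z₂ | ==-≡ {a = p} refl | ==-≢ (p≢q ∘ sym)
    | ∧-zeroʳ (p == w) | ∧-zeroʳ (q == w) | ∨-identityʳ (b₁ == w) | countEdge-absent p w F₂ pF₂ = refl

  q-count : ∀ b₁ b₂ w → (b₁ == q) ≡ false → (b₂ == q) ≡ false →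
    countEdge q w ((p , b₁) ∷ (q , b₂) ∷ F₂) ≡ 𝟙 (b₂ == w) + 0
  q-count b₁ b₂ w z₁ z₂ rewrite z₁ | z₂ | ==-≡ {a = q} refl | ==-≢ p≢q
    | ∧-zeroʳ (p == w) | ∧-zeroʳ (q == w) | ∨-identityʳ (b₂ == w) | countEdge-absent q w F₂ qF₂ = refl

  nbrs : ∀ w → w ≢ p → w ≢ q → countEdge p w F + countEdge q w F ≡ incidences w ((x , y) ∷ [])
  nbrs w _ _ rewrite count p w | count q w | p-count x y w xp yp | q-count x y w (==-≢ x≢q) yq =
    regroup (𝟙 (x == w)) (𝟙 (y == w))
    where
    regroup : ∀ a b → a + 0 + (b + 0) ≡ a + b + 0
    regroup = solve-∀

  away : ∀ b₁ b₂ u v → u ≢ p → u ≢ q → v ≢ p → v ≢ q → countEdge u v ((p , b₁) ∷ (q , b₂) ∷ F₂) ≡ countEdge u v F₂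
  away b₁ b₂ u v up uq vp vq
    rewrite ==-≢ (up ∘ sym) | ==-≢ (uq ∘ sym) | ==-≢ (vp ∘ sym) | ==-≢ (vq ∘ sym) = refl

  realise : ∀ M → Pointwise Orients ((x , y) ∷ []) M → Σ (FactorState N P) λ s →
      (∀ w → factorCount s p w ≡ outdegree w M) ×
      (∀ w → factorCount s q w ≡ indegree w M) ×
      (∀ u v → u ≢ p → u ≢ q → v ≢ p → v ≢ q → factorCount s u v ≡ countEdge u v F)
  realise _ (keep ∷ []) =
    ((p , x) ∷ (q , y) ∷ F₂ , inj₂ (prop , λ v → ≡.trans (sym (inc v)) (once v))) ,
    (λ w → p-count x y w xp yp) , (λ w → q-count x y w (==-≢ x≢q) yq) ,
    λ u v _ _ _ _ → sym (count u v)
  realise _ (turn ∷ []) =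
    ((p , y) ∷ (q , x) ∷ F₂ , inj₂ (prop , λ v → ≡.trans (exchanged v) (≡.trans (sym (inc v)) (once v)))) ,
    (λ w → p-count y x w yp xp) , (λ w → q-count y x w yq (==-≢ x≢q)) ,
    λ u v up uq vp vq → ≡.trans (away y x u v up uq vp vq)
      (≡.trans (sym (away x y u v up uq vp vq)) (sym (count u v)))
    where
    exchanged : ∀ v → incidences v ((p , y) ∷ (q , x) ∷ F₂) ≡ incidences v ((p , x) ∷ (q , y) ∷ F₂)
    exchanged v = regroup (𝟙 (p == v)) (𝟙 (y == v)) (𝟙 (q == v)) (𝟙 (x == v)) _
      where
      regroup : ∀ a b c d e → a + b + (c + d + e) ≡ a + d + (c + b + e)
      regroup = solve-∀

-- The arcs are pooled, so that one orientation can be balanced over the sum although neither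
-- summand need admit a balanced one.
Switch-+ : {p q : Fin N} {g h : Mult N} {S T : Set} {g' : S → Mult N} {h' : T → Mult N} →
  Switch p q g S g' → Switch p q h T h' →
  Switch p q (λ u v → g u v + h u v) (S × T) (λ s u v → g' (proj₁ s) u v + h' (proj₂ s) u v)
Switch-+ {p = p} {q} {g} {h} {S} {T} {g'} {h'} a b = record
  { arcs = arcs a ++ arcs b
  ; avoids-p = ≡.trans (incidences-++ p (arcs a) (arcs b)) (cong₂ _+_ (avoids-p a) (avoids-p b))
  ; avoids-q = ≡.trans (incidences-++ q (arcs a) (arcs b)) (cong₂ _+_ (avoids-q a) (avoids-q b))
  ; neighbours = λ w wp wq → ≡.trans (regroup (g p w) (h p w) (g q w) (h q w))
      (≡.trans (cong₂ _+_ (neighbours a w wp wq) (neighbours b w wp wq)) (sym (incidences-++ w (arcs a) (arcs b))))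
  ; realize = realise
  }
  where
  open Switch
  regroup : ∀ a b c d → a + b + (c + d) ≡ a + c + (b + d)
  regroup = solve-∀
  realise : ∀ M → Pointwise Orients (arcs a ++ arcs b) M → Σ (S × T) λ s →
      (∀ w → g' (proj₁ s) p w + h' (proj₂ s) p w ≡ outdegree w M) ×
      (∀ w → g' (proj₁ s) q w + h' (proj₂ s) q w ≡ indegree w M) ×
      (∀ u v → u ≢ p → u ≢ q → v ≢ p → v ≢ q → g' (proj₁ s) u v + h' (proj₂ s) u v ≡ g u v + h u v)
  realise M o with Pointwise-++⁻ (arcs a) o
  ... | K , L , refl , oK , oL with realize a K oK | realize b L oL
  ...   | s , sp , sq , saway | t , tp , tq , taway = (s , t) ,
    (λ w → ≡.trans (cong₂ _+_ (sp w) (tp w)) (sym (countWhere-++ _ K L))) ,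
    (λ w → ≡.trans (cong₂ _+_ (sq w) (tq w)) (sym (countWhere-++ _ K L))) ,
    λ u v up uq vp vq → cong₂ _+_ (saway u v up uq vp vq) (taway u v up uq vp vq)

-- Covers a colour that misses the part of p and q: nothing is re-split there, but its state may
-- still move to a type that records the new twin pair.
Switch-idle : {p q : Fin N} {g : Mult N} {S : Set} {g' : S → Mult N} (s : S) → (∀ u v → g' s u v ≡ g u v) →
  (∀ w → g p w ≡ 0) → (∀ w → g q w ≡ 0) → Switch p q g S g'
Switch-idle {p = p} {q} s same p₀ q₀ = record
  { arcs = [] ; avoids-p = refl ; avoids-q = refl
  ; neighbours = λ w _ _ → cong₂ _+_ (p₀ w) (q₀ w)
  ; realize = λ { [] [] → s , (λ w → ≡.trans (same p w) (p₀ w)) , (λ w → ≡.trans (same q w) (q₀ w)) , λ u v _ _ _ _ → same u v } }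

Switch-map : {p q : Fin N} {g : Mult N} {S T : Set} {g' : S → Mult N} {h' : T → Mult N} (f : S → T) →
  (∀ s u v → h' (f s) u v ≡ g' s u v) → Switch p q g S g' → Switch p q g T h'
Switch-map {p = p} {q} f same a = record
  { arcs = arcs ; avoids-p = avoids-p ; avoids-q = avoids-q ; neighbours = neighbours
  ; realize = λ M o → case realize M o of λ where
      (s , sp , sq , saway) → f s , (λ w → ≡.trans (same s p w) (sp w)) , (λ w → ≡.trans (same s q w) (sq w)) ,
        λ u v up uq vp vq → ≡.trans (same s u v) (saway u v up uq vp vq) }
  where open Switch a

double-injective : ∀ a b → a + a ≡ b + b → a ≡ b
double-injective zero zero _ = refl
double-injective (suc a) (suc b) eq = cong suc (double-injective a b (suc-injective (suc-injective
  (≡.trans (cong suc (sym (+-suc a a))) (≡.trans eq (cong suc (+-suc b b)))))))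

-- `outdegree w M` and `indegree w M` are the new multiplicities of w with p and with q. Balance
-- makes them equal, their sum is the old total μ p w + μ q w, and twins share this total equally,
-- so both are μ p w. No arc ends at p or q, in accordance with μ vanishing between them.
rebalance : {p q : Fin N} {μ g : Mult N} {S : Set} {g' : S → Mult N} → Switch p q g S g' →
  (∀ s u v → g' s u v ≡ g' s v u) → (∀ u v → μ u v ≡ μ v u) →
  (∀ w → μ q w ≡ μ p w) → μ p p ≡ 0 → (∀ u v → g u v ≡ μ u v) →
  Σ S λ s → ∀ u v → g' s u v ≡ μ u v
rebalance {p = p} {q} {μ} {g} {S} {g'} switch g'-sym μ-sym twins pp g≡μ
  with balancedOrientation (even⇒Eulerian _ arcs refl even)
  where
  open Switch switch
  even : ∀ v → Even (incidences v arcs)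
  even v with v Fin.≟ p | v Fin.≟ q
  ... | yes refl | _ = 0 , avoids-p
  ... | no _ | yes refl = 0 , avoids-q
  ... | no vp | no vq = μ p v , ≡.trans (sym (neighbours v vp vq))
          (cong₂ _+_ (g≡μ p v) (≡.trans (g≡μ q v) (twins v)))
... | M , o , balanced with Switch.realize switch M o
...   | s , sp , sq , saway = s , everywhere
  where
  open Switch switch
  pq = ≡.trans (μ-sym p q) (≡.trans (twins p) pp)
  doubled : ∀ w → outdegree w M + outdegree w M ≡ μ p w + μ p w
  doubled w = ≡.trans (cong (outdegree w M +_) (balanced w)) (≡.trans (sym (orients-incidences o w)) total)
    where
    total : incidences w arcs ≡ μ p w + μ p w
    total with w Fin.≟ p | w Fin.≟ q
    ... | yes refl | _ rewrite pp = avoids-p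
    ... | no _ | yes refl rewrite pq = avoids-q
    ... | no wp | no wq = ≡.trans (sym (neighbours w wp wq))
            (cong₂ _+_ (g≡μ p w) (≡.trans (g≡μ q w) (twins w)))
  at-p : ∀ w → g' s p w ≡ μ p w
  at-p w = ≡.trans (sp w) (double-injective _ _ (doubled w))
  at-q : ∀ w → g' s q w ≡ μ q w
  at-q w = ≡.trans (sq w) (≡.trans (sym (balanced w)) (≡.trans (double-injective _ _ (doubled w)) (sym (twins w))))
  everywhere : ∀ u v → g' s u v ≡ μ u v
  everywhere u v with u Fin.≟ p | u Fin.≟ q | v Fin.≟ p | v Fin.≟ q
  ... | yes refl | _ | _ | _ = at-p v
  ... | no _ | yes refl | _ | _ = at-q v
  ... | no _ | no _ | yes refl | _ = ≡.trans (g'-sym s u v) (≡.trans (at-p u) (μ-sym v u))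
  ... | no _ | no _ | no _ | yes refl = ≡.trans (g'-sym s u v) (≡.trans (at-q u) (μ-sym v u))
  ... | no up | no uq | no vp | no vq = ≡.trans (saway u v up uq vp vq) (g≡μ u v)

-- Lifting edges to matchings

∑-zero : (f : Fin n → ℕ) → (∀ i → f i ≡ 0) → ∑ f ≡ 0
∑-zero {n} f z = ≡.trans (sum-cong-≗ z) (sum-replicate-zero n)

∑-pick : (i : Fin n) (f : Fin n → ℕ) → ∑ (λ j → 𝟙 (j == i) * f j) ≡ f i
∑-pick {suc n} zero f = ≡.trans (cong₂ _+_ (*-identityˡ (f zero)) (∑-zero {n} _ λ _ → refl)) (+-identityʳ (f zero))
∑-pick (suc i) f = ∑-pick i (f ∘ suc)

∑-++ : ∀ m k (f : Fin (m + k) → ℕ) → ∑ f ≡ ∑ (λ i → f (i ↑ˡ k)) + ∑ (λ i → f (m ↑ʳ i))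
∑-++ zero k f = refl
∑-++ (suc m) k f = ≡.trans (cong (f zero +_) (∑-++ m k (f ∘ suc))) (sym (+-assoc (f zero) _ _))

∑-combine : ∀ n m (f : Fin (n * m) → ℕ) → ∑ f ≡ ∑ {n} (λ i → ∑ {m} (λ j → f (combine i j)))
∑-combine zero m f = refl
∑-combine (suc n) m f = ≡.trans (∑-++ m (n * m) f) (cong (∑ (λ j → f (j ↑ˡ n * m)) +_) (∑-combine n m (λ i → f (m ↑ʳ i))))

combine-== : ∀ {m} (a b : Fin n) (j k : Fin m) → (combine a j == combine b k) ≡ (a == b) ∧ (j == k)
combine-== a b j k with a Fin.≟ b | j Fin.≟ k
... | yes refl | yes refl = ==-≡ {a = combine a j} refl
... | yes _ | no j≢k = ==-≢ (j≢k ∘ proj₂ ∘ combine-injective a j b k)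
... | no a≢b | _ = ==-≢ (a≢b ∘ proj₁ ∘ combine-injective a j b k)

isEdge⇒ : (a b c d : Fin n) → isEdge a b (c , d) ≡ true → (c ≡ a × d ≡ b) ⊎ (c ≡ b × d ≡ a)
isEdge⇒ a b c d e with c Fin.≟ a | d Fin.≟ b | c Fin.≟ b | d Fin.≟ a
... | yes c≡a | yes d≡b | _ | _ = inj₁ (c≡a , d≡b)
... | yes _ | no _ | yes c≡b | yes d≡a = inj₂ (c≡b , d≡a)
... | no _ | _ | yes c≡b | yes d≡a = inj₂ (c≡b , d≡a)

collect : (Fin n → List X) → List X
collect f = concat (tabulate f)

countWhere-collect : (p : X → Bool) (f : Fin n → List X) → countWhere p (collect f) ≡ ∑ (λ i → countWhere p (f i))
countWhere-collect {n = zero} p f = refl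
countWhere-collect {n = suc n} p f = ≡.trans (countWhere-++ p (f zero) _) (cong (countWhere p (f zero) +_) (countWhere-collect p (f ∘ suc)))

incidences-collect : (v : Fin N) (f : Fin n → List (Fin N × Fin N)) →
  incidences v (collect f) ≡ ∑ (λ i → incidences v (f i))
incidences-collect {n = zero} v f = refl
incidences-collect {n = suc n} v f = ≡.trans (incidences-++ v (f zero) _) (cong (incidences v (f zero) +_) (incidences-collect v (f ∘ suc)))

𝟙-∧ : ∀ x y → 𝟙 (x ∧ y) ≡ 𝟙 x * 𝟙 y
𝟙-∧ true y = sym (+-identityʳ (𝟙 y))
𝟙-∧ false y = refl

𝟙-∨ : ∀ x y → x ∧ y ≡ false → 𝟙 (x ∨ y) ≡ 𝟙 x + 𝟙 y
𝟙-∨ true false _ = refl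
𝟙-∨ false y _ = refl

-- Makes the two readings of an edge in `isEdge` disjoint when its ends differ, so that `𝟙` of the
-- disjunction becomes a sum.
∧-exclusive : ∀ x {y} z {w} → x ∧ z ≡ false → (x ∧ y) ∧ (z ∧ w) ≡ false
∧-exclusive true {y} false _ = ∧-zeroʳ y
∧-exclusive false z _ = refl

Loopless : Fin N × Fin N → Set
Loopless (a , b) = a ≢ b

module Lift (n m : ℕ) .{{_ : NonZero m}} where

  hit : ℕ → ℕ → ℕ
  hit r t = 𝟙 (r ≡ᵇ t % m)

  -- For r below m, the number of labels below t congruent to r modulo m. With r the residue of i +
  -- j it counts how many edges with these labels are lifted to the pair of indices i and j.
  hits : ℕ → ℕ → ℕ
  hits r zero = 0
  hits r (suc t) = hit r t + hits r t

  ≡ᵇ-refl : ∀ r → (r ≡ᵇ r) ≡ true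
  ≡ᵇ-refl zero = refl
  ≡ᵇ-refl (suc r) = ≡ᵇ-refl r

  ≡ᵇ-sym : ∀ r s → (r ≡ᵇ s) ≡ (s ≡ᵇ r)
  ≡ᵇ-sym zero zero = refl
  ≡ᵇ-sym zero (suc s) = refl
  ≡ᵇ-sym (suc r) zero = refl
  ≡ᵇ-sym (suc r) (suc s) = ≡ᵇ-sym r s

  ≡ᵇ-< : ∀ {r s} → s < r → (r ≡ᵇ s) ≡ false
  ≡ᵇ-< {suc r} {zero} _ = refl
  ≡ᵇ-< {suc r} {suc s} (s≤s s<r) = ≡ᵇ-< s<r

  ≡ᵇ-> : ∀ {r s} → r < s → (r ≡ᵇ s) ≡ false
  ≡ᵇ-> {r} {s} r<s = ≡.trans (≡ᵇ-sym r s) (≡ᵇ-< r<s)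

  hits-before : ∀ r t → t ≤ r → t ≤ m → hits r t ≡ 0
  hits-before r zero _ _ = refl
  hits-before r (suc t) t<r t<m = cong₂ _+_
    (cong 𝟙 (≡.trans (cong (r ≡ᵇ_) (m<n⇒m%n≡m t<m)) (≡ᵇ-< t<r)))
    (hits-before r t (<⇒≤ t<r) (<⇒≤ t<m))

  hits-after : ∀ r t → r < t → t ≤ m → hits r t ≡ 1
  hits-after r (suc t) (s≤s r≤t) t<m with m≤n⇒m<n∨m≡n r≤t
  ... | inj₁ r<t = cong₂ _+_ (cong 𝟙 (≡.trans (cong (r ≡ᵇ_) (m<n⇒m%n≡m t<m)) (≡ᵇ-> r<t)))
          (hits-after r t r<t (<⇒≤ t<m))
  ... | inj₂ refl = cong₂ _+_ (cong 𝟙 (≡.trans (cong (r ≡ᵇ_) (m<n⇒m%n≡m t<m)) (≡ᵇ-refl r)))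
          (hits-before r r ≤-refl (<⇒≤ t<m))

  hits-period : ∀ r t → r < m → hits r (t + m) ≡ suc (hits r t)
  hits-period r zero r<m = hits-after r m r<m ≤-refl
  hits-period r (suc t) r<m = ≡.trans
    (cong₂ _+_ (cong (λ s → 𝟙 (r ≡ᵇ s)) ([m+n]%n≡m%n t m)) (hits-period r t r<m))
    (+-suc (hit r t) (hits r t))

  -- Each period of m labels contains the residue once. This is where the factor m in the
  -- multiplicity of the base graph is used up: l of its l * m parallel edges reach any given pair.
  hits-multiple : ∀ r l → r < m → hits r (l * m) ≡ l
  hits-multiple r zero r<m = refl
  hits-multiple r (suc l) r<m = ≡.trans (cong (hits r) (+-comm m (l * m)))
    (≡.trans (hits-period r (l * m) r<m) (cong suc (hits-multiple r l r<m)))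

  -- Telescoping over k consecutive labels; adding `hits r t` avoids a subtraction.
  hits-window : ∀ r t k → ∑ {k} (λ i → hit r (t + toℕ i)) + hits r t ≡ hits r (t + k)
  hits-window r t zero = cong (hits r) (sym (+-identityʳ t))
  hits-window r t (suc k) = begin
    hit r (t + 0) + ∑ {k} (λ i → hit r (t + suc (toℕ i))) + hits r t
      ≡⟨ cong₂ (λ a b → a + b + hits r t) (cong (hit r) (+-identityʳ t)) (sum-cong-≗ {k} λ i → cong (hit r) (+-suc t (toℕ i))) ⟩
    hit r t + ∑ {k} (λ i → hit r (suc t + toℕ i)) + hits r t
      ≡⟨ regroup (hit r t) (∑ {k} (λ i → hit r (suc t + toℕ i))) (hits r t) ⟩
    ∑ {k} (λ i → hit r (suc t + toℕ i)) + hits r (suc t)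
      ≡⟨ hits-window r (suc t) k ⟩
    hits r (suc t + k)
      ≡⟨ cong (hits r) (+-suc t k) ⟨
    hits r (t + suc k) ∎
    where
    open ≡-Reasoning
    regroup : ∀ a b c → a + b + c ≡ b + (a + c)
    regroup = solve-∀

  -- The t-th parallel edge between two vertices is replaced by the perfect matching i + j ≡ t (mod m)
  -- between their parts; being symmetric in i and j, the rule does not depend on the orientation of the edge.
  matched : ℕ → Fin m → Fin m → Bool
  matched t i j = ((toℕ i + toℕ j) % m) ≡ᵇ t % m

  matched-sym : ∀ t i j → matched t i j ≡ matched t j i
  matched-sym t i j = cong (λ s → (s % m) ≡ᵇ t % m) (+-comm (toℕ i) (toℕ j))

  -- For fixed i the sums i + j run through m consecutive numbers, which contain the residue of t
  -- exactly once.
  matched-row : ∀ t i → ∑ (λ j → 𝟙 (matched t i j)) ≡ 1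
  matched-row t i = +-cancelʳ-≡ (hits (t % m) (toℕ i)) _ 1 (begin
    ∑ (λ j → 𝟙 (matched t i j)) + hits (t % m) (toℕ i)
      ≡⟨ cong (_+ hits (t % m) (toℕ i)) (sum-cong-≗ {m} λ j → cong 𝟙 (≡ᵇ-sym ((toℕ i + toℕ j) % m) (t % m))) ⟩
    ∑ {m} (λ j → hit (t % m) (toℕ i + toℕ j)) + hits (t % m) (toℕ i)
      ≡⟨ hits-window (t % m) (toℕ i) m ⟩
    hits (t % m) (toℕ i + m)
      ≡⟨ hits-period (t % m) (toℕ i) (m%n<n t m) ⟩
    1 + hits (t % m) (toℕ i) ∎)
    where open ≡-Reasoning

  cell : ℕ → Fin n → Fin n → Fin m → Fin m → List (Fin (n * m) × Fin (n * m))
  cell t c d k l = if matched t k l then (combine c k , combine d l) ∷ [] else []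

  liftEdge : ℕ → Fin n → Fin n → List (Fin (n * m) × Fin (n * m))
  liftEdge t c d = collect λ k → collect (cell t c d k)

  countEdge-if : (u v : Fin (n * m)) (e : Fin (n * m) × Fin (n * m)) (b : Bool) →
    countEdge u v (if b then e ∷ [] else []) ≡ 𝟙 b * 𝟙 (isEdge u v e)
  countEdge-if u v e true = refl
  countEdge-if u v e false = refl

  incidences-if : (v x y : Fin (n * m)) (b : Bool) →
    incidences v (if b then (x , y) ∷ [] else []) ≡ 𝟙 b * (𝟙 (x == v) + 𝟙 (y == v))
  incidences-if v x y true = refl
  incidences-if v x y false = refl

  countEdge-liftEdge : ∀ u v t c d → countEdge u v (liftEdge t c d) ≡
    ∑ λ k → ∑ λ l → 𝟙 (matched t k l) * 𝟙 (isEdge u v (combine c k , combine d l))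
  countEdge-liftEdge u v t c d = ≡.trans (countWhere-collect (isEdge u v) (λ k → collect (cell t c d k)))
    (sum-cong-≗ λ k → ≡.trans (countWhere-collect (isEdge u v) (cell t c d k))
      (sum-cong-≗ λ l → countEdge-if u v (combine c k , combine d l) (matched t k l)))

  ∑-pick₂ : (i j : Fin m) (f : Fin m → Fin m → ℕ) → ∑ (λ k → ∑ (λ l → 𝟙 (k == i) * (𝟙 (l == j) * f k l))) ≡ f i j
  ∑-pick₂ i j f = ≡.trans (sum-cong-≗ λ k → ≡.trans (sym (*-distribˡ-sum (𝟙 (k == i)) (λ l → 𝟙 (l == j) * f k l)))
      (cong (𝟙 (k == i) *_) (∑-pick j (f k))))
    (∑-pick i (λ k → f k j))

  -- The edge c d can lie over a b straight or crossed. As a ≢ b, at most one of the two applies,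
  -- and the symmetry of `matched` gives both the same factor.
  liftEdge-across : ∀ {a b} i j t c d → a ≢ b →
    countEdge (combine a i) (combine b j) (liftEdge t c d) ≡ 𝟙 (isEdge a b (c , d)) * 𝟙 (matched t i j)
  liftEdge-across {a} {b} i j t c d a≢b = begin
    countEdge (combine a i) (combine b j) (liftEdge t c d)
      ≡⟨ countEdge-liftEdge (combine a i) (combine b j) t c d ⟩
    ∑ (λ k → ∑ (λ l → 𝟙 (matched t k l) * 𝟙 (isEdge (combine a i) (combine b j) (combine c k , combine d l))))
      ≡⟨ sum-cong-≗ (λ k → ≡.trans (sum-cong-≗ (split k)) (∑-distrib-+ (S k) (T k))) ⟩
    ∑ (λ k → ∑ (S k) + ∑ (T k))
      ≡⟨ ∑-distrib-+ (λ k → ∑ (S k)) (λ k → ∑ (T k)) ⟩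
    ∑ (λ k → ∑ (S k)) + ∑ (λ k → ∑ (T k))
      ≡⟨ cong₂ _+_ (∑-pick₂ i j (λ k l → 𝟙 straight * 𝟙 (matched t k l))) (∑-pick₂ j i (λ k l → 𝟙 crossed * 𝟙 (matched t k l))) ⟩
    𝟙 straight * 𝟙 (matched t i j) + 𝟙 crossed * 𝟙 (matched t j i)
      ≡⟨ cong (λ x → 𝟙 straight * 𝟙 (matched t i j) + 𝟙 crossed * 𝟙 x) (matched-sym t j i) ⟩
    𝟙 straight * 𝟙 (matched t i j) + 𝟙 crossed * 𝟙 (matched t i j)
      ≡⟨ *-distribʳ-+ (𝟙 (matched t i j)) (𝟙 straight) (𝟙 crossed) ⟨
    (𝟙 straight + 𝟙 crossed) * 𝟙 (matched t i j)
      ≡⟨ cong (_* 𝟙 (matched t i j)) (𝟙-∨ straight crossed (∧-exclusive (c == a) (c == b) exclusive)) ⟨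
    𝟙 (isEdge a b (c , d)) * 𝟙 (matched t i j) ∎
    where
    open ≡-Reasoning
    straight crossed : Bool
    straight = (c == a) ∧ (d == b)
    crossed = (c == b) ∧ (d == a)
    S T : Fin m → Fin m → ℕ
    S k l = 𝟙 (k == i) * (𝟙 (l == j) * (𝟙 straight * 𝟙 (matched t k l)))
    T k l = 𝟙 (k == j) * (𝟙 (l == i) * (𝟙 crossed * 𝟙 (matched t k l)))
    exclusive : (c == a) ∧ (c == b) ≡ false
    exclusive with c Fin.≟ a
    ... | yes refl = ==-≢ a≢b
    ... | no _ = refl
    distribute : ∀ M p q x y r s z w → M * (x * p * (y * q) + z * r * (w * s)) ≡ p * (q * (x * y * M)) + r * (s * (z * w * M))
    distribute = solve-∀
    split : ∀ k l → 𝟙 (matched t k l) * 𝟙 (isEdge (combine a i) (combine b j) (combine c k , combine d l)) ≡ S k l + T k l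
    split k l rewrite combine-== c a k i | combine-== d b l j | combine-== c b k j | combine-== d a l i
      | 𝟙-∨ (((c == a) ∧ (k == i)) ∧ ((d == b) ∧ (l == j))) (((c == b) ∧ (k == j)) ∧ ((d == a) ∧ (l == i)))
          (∧-exclusive ((c == a) ∧ (k == i)) ((c == b) ∧ (k == j)) (∧-exclusive (c == a) (c == b) exclusive))
      | 𝟙-∧ ((c == a) ∧ (k == i)) ((d == b) ∧ (l == j)) | 𝟙-∧ ((c == b) ∧ (k == j)) ((d == a) ∧ (l == i))
      | 𝟙-∧ (c == a) (k == i) | 𝟙-∧ (d == b) (l == j) | 𝟙-∧ (c == b) (k == j) | 𝟙-∧ (d == a) (l == i)
      | 𝟙-∧ (c == a) (d == b) | 𝟙-∧ (c == b) (d == a) =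
      distribute (𝟙 (matched t k l)) (𝟙 (k == i)) (𝟙 (l == j)) (𝟙 (c == a)) (𝟙 (d == b))
        (𝟙 (k == j)) (𝟙 (l == i)) (𝟙 (c == b)) (𝟙 (d == a))

  liftEdge-inside : ∀ a i j t {c d} → c ≢ d → countEdge (combine a i) (combine a j) (liftEdge t c d) ≡ 0
  liftEdge-inside a i j t {c} {d} c≢d = ≡.trans (countEdge-liftEdge (combine a i) (combine a j) t c d)
    (∑-zero _ λ k → ∑-zero _ λ l → ≡.trans (cong (λ b → 𝟙 (matched t k l) * 𝟙 b) (absent k l)) (*-zeroʳ (𝟙 (matched t k l))))
    where
    absent : ∀ k l → isEdge (combine a i) (combine a j) (combine c k , combine d l) ≡ false
    absent k l rewrite combine-== c a k i | combine-== d a l j | combine-== c a k j | combine-== d a l i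
      with c Fin.≟ a | d Fin.≟ a
    ... | yes refl | yes refl = contradiction refl c≢d
    ... | yes _ | no _ = ≡.trans (cong₂ _∨_ (∧-zeroʳ (k == i)) (∧-zeroʳ (k == j))) refl
    ... | no _ | _ = refl

  liftEdge-incidences : ∀ a i t c d → incidences (combine a i) (liftEdge t c d) ≡ 𝟙 (c == a) + 𝟙 (d == a)
  liftEdge-incidences a i t c d = begin
    incidences (combine a i) (liftEdge t c d)
      ≡⟨ ≡.trans (incidences-collect (combine a i) (λ k → collect (cell t c d k))) (sum-cong-≗ λ k →
           ≡.trans (incidences-collect (combine a i) (cell t c d k)) (sum-cong-≗ λ l →
             ≡.trans (incidences-if (combine a i) (combine c k) (combine d l) (matched t k l)) (split k l))) ⟩
    ∑ (λ k → ∑ (λ l → S k l + T l k))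
      ≡⟨ sum-cong-≗ (λ k → ∑-distrib-+ (S k) (λ l → T l k)) ⟩
    ∑ (λ k → ∑ (S k) + ∑ (λ l → T l k))
      ≡⟨ ∑-distrib-+ (λ k → ∑ (S k)) (λ k → ∑ (λ l → T l k)) ⟩
    ∑ (λ k → ∑ (S k)) + ∑ (λ k → ∑ (λ l → T l k))
      -- `T` has its indices transposed by `matched-sym`; exchanging the sums turns the column sum
      -- into a row sum, so `matched-row` serves both ends of the edge.
      ≡⟨ cong (∑ (λ k → ∑ (S k)) +_) (∑-comm (λ k l → T l k)) ⟩
    ∑ (λ k → ∑ (S k)) + ∑ (λ l → ∑ (T l))
      ≡⟨ cong₂ _+_ (row (c == a) λ k l → refl) (row (d == a) λ k l → refl) ⟩
    𝟙 (c == a) + 𝟙 (d == a) ∎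
    where
    open ≡-Reasoning
    S T : Fin m → Fin m → ℕ
    S k l = 𝟙 (k == i) * (𝟙 (c == a) * 𝟙 (matched t k l))
    T k l = 𝟙 (k == i) * (𝟙 (d == a) * 𝟙 (matched t k l))
    row : ∀ x {f : Fin m → Fin m → ℕ} → (∀ k l → f k l ≡ 𝟙 (k == i) * (𝟙 x * 𝟙 (matched t k l))) →
      ∑ (λ k → ∑ (f k)) ≡ 𝟙 x
    row x {f} eq = begin
      ∑ (λ k → ∑ (f k))
        ≡⟨ sum-cong-≗ (λ k → ≡.trans (sum-cong-≗ (eq k)) (≡.trans
             (sym (*-distribˡ-sum (𝟙 (k == i)) (λ l → 𝟙 x * 𝟙 (matched t k l))))
             (cong (𝟙 (k == i) *_) (sym (*-distribˡ-sum (𝟙 x) (λ l → 𝟙 (matched t k l))))))) ⟩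
      ∑ (λ k → 𝟙 (k == i) * (𝟙 x * ∑ (λ l → 𝟙 (matched t k l))))
        ≡⟨ ∑-pick i (λ k → 𝟙 x * ∑ (λ l → 𝟙 (matched t k l))) ⟩
      𝟙 x * ∑ (λ l → 𝟙 (matched t i l))
        ≡⟨ cong (𝟙 x *_) (matched-row t i) ⟩
      𝟙 x * 1
        ≡⟨ *-identityʳ (𝟙 x) ⟩
      𝟙 x ∎
    split : ∀ k l → 𝟙 (matched t k l) * (𝟙 (combine c k == combine a i) + 𝟙 (combine d l == combine a i)) ≡ S k l + T l k
    split k l rewrite combine-== c a k i | combine-== d a l i | matched-sym t l k =
      boolean (𝟙 (matched t k l)) (c == a) (k == i) (d == a) (l == i)
      where
      ring : ∀ M x k y l → M * (x * k + y * l) ≡ k * (x * M) + l * (y * M)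
      ring = solve-∀
      boolean : ∀ M x k y l → M * (𝟙 (x ∧ k) + 𝟙 (y ∧ l)) ≡ 𝟙 k * (𝟙 x * M) + 𝟙 l * (𝟙 y * M)
      boolean M x k y l rewrite 𝟙-∧ x k | 𝟙-∧ y l = ring M (𝟙 x) (𝟙 k) (𝟙 y) (𝟙 l)

  -- `off a b` is the number of labels already spent on the pair, and the parallel edges in the list
  -- receive the next ones, the last of them first.
  liftEdges : Mult n → List (Fin n × Fin n) → List (Fin (n * m) × Fin (n * m))
  liftEdges off [] = []
  liftEdges off ((a , b) ∷ E) = liftEdge (countEdge a b E + off a b) a b ++ liftEdges off E

  -- The copies of a b carry consecutive labels from `off a b` on, so the counts telescope to the
  -- growth of `hits`. Symmetry of `off` gives an edge listed as (b , a) the same label.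
  liftEdges-across : (off : Mult n) → (∀ a b → off a b ≡ off b a) → ∀ {a b} i j → a ≢ b → ∀ E →
    countEdge (combine a i) (combine b j) (liftEdges off E) + hits ((toℕ i + toℕ j) % m) (off a b) ≡
    hits ((toℕ i + toℕ j) % m) (countEdge a b E + off a b)
  liftEdges-across off off-sym i j a≢b [] = refl
  liftEdges-across off off-sym {a} {b} i j a≢b ((c , d) ∷ E)
    rewrite countWhere-++ (isEdge (combine a i) (combine b j)) (liftEdge (countEdge c d E + off c d) c d) (liftEdges off E)
          | liftEdge-across i j (countEdge c d E + off c d) c d a≢b
    = ≡.trans (+-assoc (𝟙 (isEdge a b (c , d)) * 𝟙 (matched (countEdge c d E + off c d) i j)) _ _)
        (≡.trans (cong (𝟙 (isEdge a b (c , d)) * 𝟙 (matched (countEdge c d E + off c d) i j) +_)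
          (liftEdges-across off off-sym i j a≢b E)) (head (isEdge a b (c , d)) refl))
    where
    head : ∀ e → isEdge a b (c , d) ≡ e →
      𝟙 e * 𝟙 (matched (countEdge c d E + off c d) i j) + hits ((toℕ i + toℕ j) % m) (countEdge a b E + off a b) ≡
      hits ((toℕ i + toℕ j) % m) (𝟙 e + countEdge a b E + off a b)
    head false _ = refl
    head true e = cong (_+ hits ((toℕ i + toℕ j) % m) (countEdge a b E + off a b))
      (≡.trans (+-identityʳ _) (cong (λ t → 𝟙 (matched t i j)) same-label))
      where
      same-label : countEdge c d E + off c d ≡ countEdge a b E + off a b
      same-label with isEdge⇒ a b c d e
      ... | inj₁ (refl , refl) = refl
      ... | inj₂ (refl , refl) = cong₂ _+_ (countEdge-sym b a E) (off-sym b a)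

  liftEdges-inside : (off : Mult n) → ∀ a i j {E} → All Loopless E →
    countEdge (combine a i) (combine a j) (liftEdges off E) ≡ 0
  liftEdges-inside off a i j [] = refl
  liftEdges-inside off a i j {(c , d) ∷ E} (c≢d ∷ ll) = ≡.trans
    (countWhere-++ _ (liftEdge (countEdge c d E + off c d) c d) (liftEdges off E))
    (cong₂ _+_ (liftEdge-inside a i j _ c≢d) (liftEdges-inside off a i j ll))

  liftEdges-incidences : (off : Mult n) → ∀ a i E → incidences (combine a i) (liftEdges off E) ≡ incidences a E
  liftEdges-incidences off a i [] = refl
  liftEdges-incidences off a i ((c , d) ∷ E) = ≡.trans
    (incidences-++ _ (liftEdge (countEdge c d E + off c d) c d) (liftEdges off E))
    (cong₂ _+_ (liftEdge-incidences a i _ c d) (liftEdges-incidences off a i E))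

-- Visits and degrees in cycles

occurrences-absent : (v : Fin N) {C : List (Fin N)} → All (v ≢_) C → occurrences v C ≡ 0
occurrences-absent v [] = refl
occurrences-absent v (v≢x ∷ r) = cong₂ _+_ (cong 𝟙 (==-≢ (v≢x ∘ sym))) (occurrences-absent v r)

occurrences-unique : (v : Fin N) {C : List (Fin N)} → Unique C → occurrences v C ≡ 𝟙 (occurs v C)
occurrences-unique v [] = refl
occurrences-unique v {x ∷ C} (x∉C ∷ u) with x Fin.≟ v
... | yes refl = cong suc (occurrences-absent x x∉C)
... | no _ = occurrences-unique v u

pathEdges-loopless : {x : Fin N} (a : Fin N) (L : List (Fin N)) → Unique (a ∷ L) → All (x ≢_) (a ∷ L) →
  All Loopless (pathEdges (a ∷ L ++ x ∷ []))
pathEdges-loopless a [] _ (x≢a ∷ []) = (x≢a ∘ sym) ∷ []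
pathEdges-loopless a (b ∷ L) ((a≢b ∷ _) ∷ u) (_ ∷ x∉) = a≢b ∷ pathEdges-loopless b L u x∉

cycleEdges-loopless : {C : List (Fin N)} → IsCycle C → All Loopless (cycleEdges C)
cycleEdges-loopless {C = x ∷ []} (_ , s≤s ())
cycleEdges-loopless {C = x ∷ y ∷ C} (x∉@(x≢y ∷ _) ∷ u , _)
  rewrite cycleEdges-pathEdges x (y ∷ C) = x≢y ∷ pathEdges-loopless y C u x∉

incidences-pathEdges : (v x y : Fin N) (L : List (Fin N)) →
  incidences v (pathEdges (x ∷ L ++ y ∷ [])) ≡ 𝟙 (x == v) + (occurrences v L + occurrences v L) + 𝟙 (y == v)
incidences-pathEdges v x y [] = flatten (𝟙 (x == v)) (𝟙 (y == v))
  where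
  flatten : ∀ a b → a + b + 0 ≡ a + 0 + b
  flatten = solve-∀
incidences-pathEdges v x y (z ∷ L) rewrite incidences-pathEdges v z y L =
  regroup (𝟙 (x == v)) (𝟙 (z == v)) (occurrences v L) (𝟙 (y == v))
  where
  regroup : ∀ a b c d → a + b + (b + (c + c) + d) ≡ a + (b + c + (b + c)) + d
  regroup = solve-∀

incidences-cycleEdges : (v : Fin N) (C : List (Fin N)) →
  incidences v (cycleEdges C) ≡ occurrences v C + occurrences v C
incidences-cycleEdges v [] = refl
incidences-cycleEdges v (x ∷ C) rewrite cycleEdges-pathEdges x C | incidences-pathEdges v x x C =
  regroup (𝟙 (x == v)) (occurrences v C)
  where
  regroup : ∀ a c → a + (c + c) + a ≡ a + c + (a + c)
  regroup = solve-∀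

-- A loop counts twice at its vertex. This keeps loops out of the 1-factor, on whose diagonal
-- `partition` is silent.
simple⇒loopless : (E : List (Fin N × Fin N)) → (∀ v → incidences v E ≤ 1) → All Loopless E
simple⇒loopless [] _ = []
simple⇒loopless ((a , b) ∷ E) le = distinct ∷ simple⇒loopless E λ v → ≤-trans (m≤n+m _ (𝟙 (a == v) + 𝟙 (b == v))) (le v)
  where
  distinct : a ≢ b
  distinct refl with le a
  ... | h rewrite ==-≡ {a = a} refl = case h of λ { (s≤s ()) }

-- Assembling the lifted decomposition

cycleCount⇒occurs : (u v : Fin N) (C : List (Fin N)) → cycleCount u v C ≢ 0 → 1 ≤ occurrences u C
cycleCount⇒occurs u v C ne = n≢0⇒n>0 λ z → ne (cycleCount-absent u v C z)

cyclesCount⇒Joined : (u v : Fin N) (W : List (List (Fin N))) → 1 ≤ cyclesCount u v W → Joined W u v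
cyclesCount⇒Joined u v (C ∷ W) h with cycleCount u v C in eq
... | zero = there (cyclesCount⇒Joined u v W h)
... | suc _ = here (cycleCount⇒occurs u v C ne ,
    cycleCount⇒occurs v u C λ z → ne (≡.trans (countEdge-sym u v (cycleEdges C)) z))
  where
  ne : cycleCount u v C ≢ 0
  ne z = contradiction (≡.trans (sym eq) z) λ ()

cyclesCount-sym : (u v : Fin N) (W : List (List (Fin N))) → cyclesCount u v W ≡ cyclesCount v u W
cyclesCount-sym u v [] = refl
cyclesCount-sym u v (C ∷ W) = cong₂ _+_ (countEdge-sym u v (cycleEdges C)) (cyclesCount-sym u v W)

Joined-sym : {x y : Fin N} {W : List (List (Fin N))} → Joined W x y → Joined W y x
Joined-sym = Any.map λ (x∈ , y∈) → y∈ , x∈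

Joined⇒occurs : {x y : Fin N} {W : List (List (Fin N))} → Joined W x y → 1 ≤ occurrences x (concat W)
Joined⇒occurs {x = x} {W = C ∷ W} (here (x∈ , _)) rewrite occurrences-++ x C (concat W) = ≤-trans x∈ (m≤m+n _ _)
Joined⇒occurs {x = x} {W = C ∷ W} (there j) rewrite occurrences-++ x C (concat W) =
  ≤-trans (Joined⇒occurs j) (m≤n+m _ (occurrences x C))

∈⇒occurs : {v : Fin N} {C : List (Fin N)} → v ∈ C → occurs v C ≡ true
∈⇒occurs {v = v} (here refl) rewrite ==-≡ {a = v} refl = refl
∈⇒occurs {v = v} {x ∷ C} (there i) with x == v
... | true = refl
... | false = ∈⇒occurs i

occurs⇒∈ : (v : Fin N) (C : List (Fin N)) → occurs v C ≡ true → v ∈ C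
occurs⇒∈ v (x ∷ C) o with x Fin.≟ v
... | yes refl = here refl
... | no _ = there (occurs⇒∈ v C o)

𝟙-injective : ∀ {a b} → 𝟙 a ≡ 𝟙 b → a ≡ b
𝟙-injective {true} {true} _ = refl
𝟙-injective {false} {false} _ = refl

𝟙≤1 : ∀ b → 𝟙 b ≤ 1
𝟙≤1 true = ≤-refl
𝟙≤1 false = z≤n

occurrences≤1⇒Unique : (C : List (Fin N)) → (∀ v → occurrences v C ≤ 1) → Unique C
occurrences≤1⇒Unique [] _ = []
occurrences≤1⇒Unique (x ∷ C) le =
  All.tabulate (λ y∈C x≡y → absent (subst (_∈ C) (sym x≡y) y∈C)) ∷
  occurrences≤1⇒Unique C λ v → ≤-trans (m≤n+m _ (𝟙 (x == v))) (le v)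
  where
  present : ∀ {v} {L : List (Fin _)} → v ∈ L → 1 ≤ occurrences v L
  present {v} (here refl) rewrite ==-≡ {a = v} refl = s≤s z≤n
  present {v} {y ∷ L} (there i) = ≤-trans (present i) (m≤n+m _ (𝟙 (y == v)))
  absent : ¬ x ∈ C
  absent i with le x
  ... | h rewrite ==-≡ {a = x} refl = contradiction (≤-trans (s≤s (present i)) h) λ { (s≤s ()) }

∑-const : ∀ n c → ∑ {n} (λ _ → c) ≡ c * n
∑-const zero c = sym (*-zeroʳ c)
∑-const (suc n) c = ≡.trans (cong (c +_) (∑-const n c)) (sym (*-suc c n))

∑-occurrences : (L : List (Fin N)) → ∑ (λ v → occurrences v L) ≡ length L
∑-occurrences {N} [] = ∑-zero {N} _ λ _ → refl
∑-occurrences {N} (x ∷ L) = ≡.trans (∑-distrib-+ (λ v → 𝟙 (x == v)) (λ v → occurrences v L))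
  (cong₂ _+_ once (∑-occurrences L))
  where
  once : ∑ {N} (λ v → 𝟙 (x == v)) ≡ 1
  once = ≡.trans (sum-cong-≗ λ v → ≡.trans (cong 𝟙 (==-sym x v)) (sym (*-identityʳ _))) (∑-pick x (λ _ → 1))

sum-tabulate : (f : X → ℕ) (g : Fin n → X) → sum (map f (tabulate g)) ≡ ∑ (λ i → f (g i))
sum-tabulate {n = zero} f g = refl
sum-tabulate {n = suc n} f g = cong (f (g zero) +_) (sum-tabulate f (g ∘ suc))

Pointwise-concat⁻ : {R : X → Y → Set} (xss : List (List X)) {zs : List Y} → Pointwise R (concat xss) zs →
  ∃ λ yss → zs ≡ concat yss × Pointwise (Pointwise R) xss yss
Pointwise-concat⁻ [] [] = [] , refl , []
Pointwise-concat⁻ (xs ∷ xss) rs with Pointwise-++⁻ xs rs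
... | ys , _ , refl , r , rs' with Pointwise-concat⁻ xss rs'
...   | yss , refl , rss = ys ∷ yss , refl , r ∷ rss

-- Colours, the 1-factor and the rejoining of twins

module _ (n m : ℕ) where

  part : Fin (n * m) → Fin n
  part = quotient {n} m

  part-combine : ∀ a i → part (combine {n} {m} a i) ≡ a
  part-combine a i = cong proj₁ (remQuot-combine {n} {m} a i)

  fibrewise : (Q : Fin (n * m) → Set) → (∀ a i → Q (combine {n} {m} a i)) → ∀ x → Q x
  fibrewise Q q x = subst Q (combine-remQuot {n} m x) (q _ _)

  -- One colour class while it is being rejoined; J lists the pairs of twin vertices already brought together.
  record Colour (C : List (Fin n)) (J : List (Fin (n * m) × Fin (n * m))) : Set where
    field
      closed : List (List (Fin (n * m)))
      through : ∀ x → occurrences x (concat closed) ≡ 𝟙 (occurs (part x) C)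
      edge-joins : All (λ (a , b) → ∃₂ λ i j → Joined closed (combine a i) (combine b j)) (cycleEdges C)
      twin-joins : All (λ (x , y) → occurs (part x) C ≡ true → Joined closed x y) J
  open Colour

  colourCount : ∀ {C J} → Colour C J → Mult (n * m)
  colourCount c u v = cyclesCount u v (closed c)

  switchColour : ∀ {C J p q} → p ≢ q → part p ≡ part q → (c : Colour C J) →
    (∀ {s t} → s ≡ p ⊎ s ≡ q → t ≡ p ⊎ t ≡ q → colourCount c s t ≡ 0) →
    Switch p q (colourCount c) (Colour C ((p , q) ∷ J)) colourCount
  switchColour {C} {J} {p} {q} p≢q twins c isolated with occurs (part p) C in eq
  ... | true = Switch-map rejoin (λ _ _ _ → refl) (switchTrails p q (closed c) p≢q (loops p q (closed c) p≢q p₁ q₁) p₁ q₁ isolated)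
    where
    p₁ = ≡.trans (through c p) (cong 𝟙 eq)
    q₁ = ≡.trans (through c q) (cong 𝟙 (≡.trans (cong (λ a → occurs a C) (sym twins)) eq))
    rejoin : Rejoined p q (closed c) → Colour C ((p , q) ∷ J)
    rejoin S = record
      { closed = trails S
      ; through = λ x → ≡.trans (same-occs S x) (through c x)
      ; edge-joins = All.map (λ (i , j , e) → i , j , same-joins S _ _ e) (edge-joins c)
      ; twin-joins = (λ _ → new-join S) ∷ All.map (λ e o → same-joins S _ _ (e o)) (twin-joins c)
      }
  -- C avoids the part of p and q, so the colour meets neither and the new entry of `twin-joins` is
  -- vacuous.
  ... | false = Switch-idle unchanged (λ _ _ → refl)
      (λ w → cyclesCount-absent p w (closed c) (≡.trans (through c p) (cong 𝟙 eq)))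
      (λ w → cyclesCount-absent q w (closed c) (≡.trans (through c q) (cong 𝟙 (≡.trans (cong (λ a → occurs a C) (sym twins)) eq))))
    where
    unchanged : Colour C ((p , q) ∷ J)
    unchanged = record
      { closed = closed c ; through = through c ; edge-joins = edge-joins c
      ; twin-joins = (λ o → contradiction (≡.trans (sym eq) o) λ ()) ∷ twin-joins c }

  Colours : List (List (Fin n)) → List (Fin (n * m) × Fin (n * m)) → Set
  Colours Cs J = All (λ C → Colour C J) Cs

  coloursCount : ∀ {Cs J} → Colours Cs J → Mult (n * m)
  coloursCount [] u v = 0
  coloursCount (c ∷ cs) u v = colourCount c u v + coloursCount cs u v

  coloursCount-sym : ∀ {Cs J} (cs : Colours Cs J) u v → coloursCount cs u v ≡ coloursCount cs v u
  coloursCount-sym [] u v = refl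
  coloursCount-sym (c ∷ cs) u v = cong₂ _+_ (cyclesCount-sym u v (closed c)) (coloursCount-sym cs u v)

  switchColours : ∀ {Cs J p q} → p ≢ q → part p ≡ part q → (cs : Colours Cs J) →
    (∀ {s t} → s ≡ p ⊎ s ≡ q → t ≡ p ⊎ t ≡ q → coloursCount cs s t ≡ 0) →
    Switch p q (coloursCount cs) (Colours Cs ((p , q) ∷ J)) coloursCount
  switchColours p≢q twins [] isolated = Switch-idle [] (λ _ _ → refl) (λ _ → refl) (λ _ → refl)
  switchColours p≢q twins (c ∷ cs) isolated = Switch-map (λ (c , cs) → c ∷ cs) (λ _ _ _ → refl)
    (Switch-+ (switchColour p≢q twins c λ s∈ t∈ → m+n≡0⇒m≡0 _ (isolated s∈ t∈))
              (switchColours p≢q twins cs λ s∈ t∈ → m+n≡0⇒n≡0 (colourCount c _ _) (isolated s∈ t∈)))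

  State : Set → List (List (Fin n)) → List (Fin (n * m) × Fin (n * m)) → Set
  State P Cs J = Colours Cs J × FactorState (n * m) P

  stateCount : ∀ {P Cs J} → State P Cs J → Mult (n * m)
  stateCount s u v = coloursCount (proj₁ s) u v + factorCount (proj₂ s) u v

  -- Unlike in `partition`, u = v is included. `partiteMult` is 0 there, so no colour contains a
  -- loop, as `switchTrails` demands.
  Balanced : ∀ {P Cs J} → ℕ → State P Cs J → Set
  Balanced l s = ∀ u v → stateCount s u v ≡ partiteMult n m l u v

  TwinPair : Fin (n * m) × Fin (n * m) → Set
  TwinPair (p , q) = p ≢ q × part p ≡ part q

  partite-twins : ∀ l {u v} → part u ≡ part v → partiteMult n m l u v ≡ 0
  partite-twins l eq rewrite ==-≡ eq = refl

  -- Balance is restored after each pair; it is what makes the next two twins non-adjacent and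
  -- equally met, so that they can be re-split in turn.
  rejoinTwins : ∀ {P Cs} l J → All TwinPair J → (s : State P Cs []) → Balanced l s →
    Σ (State P Cs J) (Balanced l)
  rejoinTwins l [] [] s bal = s , bal
  rejoinTwins l ((p , q) ∷ J) ((p≢q , twins) ∷ tw) s₀ bal₀ with rejoinTwins l J tw s₀ bal₀
  ... | s@(cs , f) , bal = rebalance
      (Switch-+ (switchColours p≢q twins cs λ s∈ t∈ → m+n≡0⇒m≡0 _ (isolated s∈ t∈))
                (switchFactor p q p≢q f (m+n≡0⇒n≡0 (coloursCount cs p q) (isolated (inj₁ refl) (inj₂ refl)))))
      (λ s u v → cong₂ _+_ (coloursCount-sym (proj₁ s) u v) (countEdge-sym u v (proj₁ (proj₂ s))))
      (λ u v → cong (λ b → if b then 0 else l) (==-sym (part u) (part v)))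
      (λ w → cong (λ a → if a == part w then 0 else l) (sym twins))
      (partite-twins l {p} {p} refl) bal
    where
    side : ∀ {s} → s ≡ p ⊎ s ≡ q → part s ≡ part p
    side (inj₁ refl) = refl
    side (inj₂ refl) = sym twins
    isolated : ∀ {s t} → s ≡ p ⊎ s ≡ q → t ≡ p ⊎ t ≡ q → coloursCount cs s t + factorCount f s t ≡ 0
    isolated {s} {t} s∈ t∈ = ≡.trans (bal s t) (partite-twins l {s} {t} (≡.trans (side s∈) (sym (side t∈))))

  -- Every other part contributes m vertices of multiplicity l. The degrees agree, so the odd-degree
  -- condition of a 1-factor carries over to the lift.
  degree-partite : ∀ l x → degree (partiteMult n m l) x ≡ degree (completeMult n (l * m)) (part x)
  degree-partite l x = begin
    sum (map (partiteMult n m l x) (allFin (n * m)))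
      ≡⟨ ≡.trans (sum-tabulate (partiteMult n m l x) (λ i → i)) (∑-combine n m (partiteMult n m l x)) ⟩
    ∑ {n} (λ b → ∑ {m} (λ j → partiteMult n m l x (combine {n} {m} b j)))
      ≡⟨ sum-cong-≗ (λ b → ≡.trans (sum-cong-≗ λ j → cong (λ c → if part x == c then 0 else l) (part-combine b j))
           (≡.trans (∑-const m (if part x == b then 0 else l)) (scaled (part x == b)))) ⟩
    ∑ (completeMult n (l * m) (part x))
      ≡⟨ sum-tabulate (completeMult n (l * m) (part x)) (λ i → i) ⟨
    sum (map (completeMult n (l * m) (part x)) (allFin n)) ∎
    where
    open ≡-Reasoning
    scaled : ∀ b → (if b then 0 else l) * m ≡ (if b then 0 else l * m)
    scaled true = refl
    scaled false = refl

  record LiftedCycle (C : List (Fin n)) (D : List (Fin (n * m))) : Set where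
    field
      isCycle : IsCycle D
      lifted-length : length D ≡ length C * m
      lifted-occurs : ∀ x → occurs x D ≡ occurs (part x) C
  open LiftedCycle public

  lifted-lengths : ∀ {Cs Ds} → Pointwise LiftedCycle Cs Ds → map length Ds ≡ map (λ c → c * m) (map length Cs)
  lifted-lengths [] = refl
  lifted-lengths (r ∷ rs) = cong₂ _∷_ (lifted-length r) (lifted-lengths rs)

  lifted-cycles : ∀ {Cs Ds} → Pointwise LiftedCycle Cs Ds → All IsCycle Ds
  lifted-cycles [] = []
  lifted-cycles (r ∷ rs) = isCycle r ∷ lifted-cycles rs

  lifted-through : ∀ {Cs Ds} → Pointwise LiftedCycle Cs Ds → ∀ x → cyclesThrough x Ds ≡ cyclesThrough (part x) Cs
  lifted-through [] x = refl
  lifted-through (r ∷ rs) x = cong₂ (λ b k → 𝟙 b + k) (lifted-occurs r x) (lifted-through rs x)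

  lifted-classes : ∀ {α Css Dss} → Pointwise (Pointwise LiftedCycle) Css Dss →
    All (λ cl → ∀ v → cyclesThrough v cl ≡ α) Css → All (λ cl → ∀ v → cyclesThrough v cl ≡ α) Dss
  lifted-classes [] [] = []
  lifted-classes (rs ∷ rss) (a ∷ as) = (λ x → ≡.trans (lifted-through rs x) (a (part x))) ∷ lifted-classes rss as

-- The initial lift and the final cycles

module Construction (n m' l : ℕ) where

  -- The index zero is the hub of each part, and the remaining m' indices are its twins in `twin`.
  m = suc m'

  open Lift n m

  V = Fin (n * m)

  -- Supplies `edge-joins`: an edge above each base edge is what later links the parts of
  -- consecutive vertices of C.
  liftEdges-occupied : (off : Mult n) → ∀ {E} → All Loopless E →
    All (λ (c , d) → ∃₂ λ i j → 1 ≤ countEdge (combine {n} {m} c i) (combine {n} {m} d j) (liftEdges off E)) E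
  liftEdges-occupied off [] = []
  liftEdges-occupied off {(c , d) ∷ E} (c≢d ∷ ll) = (zero , j , first) ∷ All.map later (liftEdges-occupied off ll)
    where
    t = countEdge c d E + off c d
    -- The partner of index zero under label t is the residue of t itself.
    j = Fin.fromℕ< (m%n<n t m)
    split : ∀ u v → countEdge u v (liftEdge t c d ++ liftEdges off E) ≡ countEdge u v (liftEdge t c d) + countEdge u v (liftEdges off E)
    split u v = countWhere-++ (isEdge u v) (liftEdge t c d) (liftEdges off E)
    matched-j : matched t zero j ≡ true
    matched-j = ≡.trans (cong (λ s → (s % m) ≡ᵇ t % m) (toℕ-fromℕ< (m%n<n t m)))
      (≡.trans (cong (_≡ᵇ t % m) (m%n%n≡m%n t m)) (≡ᵇ-refl (t % m)))
    self : isEdge c d (c , d) ≡ true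
    self rewrite ==-≡ {a = c} refl | ==-≡ {a = d} refl = refl
    first : 1 ≤ countEdge (combine c zero) (combine d j) (liftEdge t c d ++ liftEdges off E)
    first rewrite split (combine c zero) (combine d j) | liftEdge-across zero j t c d c≢d | self | matched-j = s≤s z≤n
    later : ∀ {a b} → (∃₂ λ i k → 1 ≤ countEdge (combine {n} {m} a i) (combine {n} {m} b k) (liftEdges off E)) →
      ∃₂ λ i k → 1 ≤ countEdge (combine {n} {m} a i) (combine {n} {m} b k) (liftEdge t c d ++ liftEdges off E)
    later {a} {b} (i , k , h) = i , k , subst (1 ≤_) (sym (split (combine a i) (combine b k)))
      (≤-trans h (m≤n+m _ (countEdge (combine a i) (combine b k) (liftEdge t c d))))

  -- The lift has degree 2 at the vertices above C and 0 elsewhere. Hence it consists of closed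
  -- trails, and halving the degrees gives `through`.
  liftColour : (off : Mult n) → ∀ {C} → IsCycle C →
    Σ (Colour n m C []) λ c → ∀ u v → colourCount n m c u v ≡ countEdge u v (liftEdges off (cycleEdges C))
  liftColour off {C} cyc with closedTrails (liftEdges off (cycleEdges C)) (λ x → occurrences (part n m x) C , twice x)
    where
    twice : ∀ x → incidences x (liftEdges off (cycleEdges C)) ≡ occurrences (part n m x) C + occurrences (part n m x) C
    twice = fibrewise n m _ λ a i → ≡.trans (liftEdges-incidences off a i (cycleEdges C))
      (≡.trans (incidences-cycleEdges a C) (cong (λ b → occurrences b C + occurrences b C) (sym (part-combine n m a i))))
  ... | W , count , occ = record
        { closed = W
        ; through = fibrewise n m _ λ a i → double-injective _ _ (≡.trans (occ (combine a i))
            (≡.trans (liftEdges-incidences off a i (cycleEdges C)) (≡.trans (incidences-cycleEdges a C)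
              (cong (λ k → k + k) (≡.trans (occurrences-unique a (proj₁ cyc)) (cong (λ b → 𝟙 (occurs b C)) (sym (part-combine n m a i))))))))
        ; edge-joins = All.map (λ (i , j , h) → i , j , cyclesCount⇒Joined _ _ W (subst (1 ≤_) (sym (count _ _)) h))
            (liftEdges-occupied off (cycleEdges-loopless cyc))
        ; twin-joins = []
        } , count

  -- Each edge is labelled by the number of parallel edges in the colours after its own (including the 1-factor,
  -- which contributes base) or later in its own colour, so the labels of a parallel class are 0, …, l m − 1.
  liftColours : (base : Mult n) → (∀ a b → base a b ≡ base b a) → ∀ {Cs} → All IsCycle Cs →
    Σ (Colours n m Cs []) λ cs →
      (∀ {a b} i j → a ≢ b → coloursCount n m cs (combine a i) (combine b j) + hits ((toℕ i + toℕ j) % m) (base a b) ≡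
        hits ((toℕ i + toℕ j) % m) (cyclesCount a b Cs + base a b)) ×
      (∀ a i j → coloursCount n m cs (combine a i) (combine a j) ≡ 0)
  liftColours base base-sym [] = [] , (λ i j _ → refl) , λ a i j → refl
  liftColours base base-sym {C ∷ Cs} (cyc ∷ cycs)
    with liftColours base base-sym cycs
       | liftColour (λ a b → cyclesCount a b Cs + base a b) cyc
  ... | cs , across , inside | c , count = c ∷ cs , across' , inside'
    where
    off : Mult n
    off a b = cyclesCount a b Cs + base a b
    inside' : ∀ a i j → colourCount n m c (combine a i) (combine a j) + coloursCount n m cs (combine a i) (combine a j) ≡ 0
    inside' a i j = cong₂ _+_ (≡.trans (count _ _) (liftEdges-inside off a i j (cycleEdges-loopless cyc))) (inside a i j)
    across' : ∀ {a b} i j → a ≢ b →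
      colourCount n m c (combine a i) (combine b j) + coloursCount n m cs (combine a i) (combine b j) + hits ((toℕ i + toℕ j) % m) (base a b) ≡
      hits ((toℕ i + toℕ j) % m) (cycleCount a b C + cyclesCount a b Cs + base a b)
    across' {a} {b} i j a≢b = begin
      colourCount n m c x y + coloursCount n m cs x y + hits r (base a b)
        ≡⟨ +-assoc (colourCount n m c x y) _ _ ⟩
      colourCount n m c x y + (coloursCount n m cs x y + hits r (base a b))
        ≡⟨ cong₂ _+_ (count x y) (across i j a≢b) ⟩
      countEdge x y (liftEdges off (cycleEdges C)) + hits r (off a b)
        ≡⟨ liftEdges-across off (λ a b → cong₂ _+_ (cyclesCount-sym a b Cs) (base-sym a b)) i j a≢b (cycleEdges C) ⟩
      hits r (cycleCount a b C + off a b)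
        ≡⟨ cong (hits r) (+-assoc (cycleCount a b C) _ _) ⟨
      hits r (cycleCount a b C + cyclesCount a b Cs + base a b) ∎
      where
      open ≡-Reasoning
      x = combine a i
      y = combine b j
      r = (toℕ i + toℕ j) % m

  HasOddDegrees : Set
  HasOddDegrees = ∀ v → Odd (degree (partiteMult n m l) v)

  initialState : ∀ {sizes} (D : CycleDecomp n (completeMult n (l * m)) sizes) →
    Σ (State n m HasOddDegrees (cycles D) []) (Balanced n m l)
  initialState D with liftColours (λ a b → countEdge a b F) (λ a b → countEdge-sym a b F) (areCycles D)
    where F = oneFactor D
  ... | cs , across , inside = (cs , F' , factor (factorOK D)) , fibrewise n m _ λ a i → fibrewise n m _ λ b j → balanced a b i j
    where
    F = oneFactor D
    -- The factor takes the labels from 0 on, and the colours continue above them, with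
    -- `countEdge a b F` as their `base`. Together they exhaust the l * m labels of the pair.
    F' = liftEdges (λ _ _ → 0) F

    factor : (F ≡ []) ⊎ ((∀ v → Odd (degree (completeMult n (l * m)) v)) × IsOneFactor F) →
      F' ≡ [] ⊎ (HasOddDegrees × IsOneFactor F')
    factor (inj₁ none) = inj₁ (cong (liftEdges (λ _ _ → 0)) none)
    factor (inj₂ (odd , once)) = inj₂ ((λ x → subst Odd (sym (degree-partite n m l x)) (odd (part n m x))) ,
      fibrewise n m _ λ a i → ≡.trans (liftEdges-incidences (λ _ _ → 0) a i F) (once a))

    loopless : (F ≡ []) ⊎ ((∀ v → Odd (degree (completeMult n (l * m)) v)) × IsOneFactor F) → All Loopless F
    loopless (inj₁ none) rewrite none = []
    loopless (inj₂ (_ , once)) = simple⇒loopless F λ v → ≤-reflexive (once v)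

    balanced : ∀ a b i j → coloursCount n m cs (combine a i) (combine b j) + countEdge (combine a i) (combine b j) F' ≡
      partiteMult n m l (combine a i) (combine b j)
    balanced a b i j rewrite part-combine n m a i | part-combine n m b j with a Fin.≟ b
    ... | yes refl = cong₂ _+_ (inside a i j) (liftEdges-inside (λ _ _ → 0) a i j (loopless (factorOK D)))
    ... | no a≢b = begin
      coloursCount n m cs x y + countEdge x y F'
        ≡⟨ cong (coloursCount n m cs x y +_) (+-identityʳ (countEdge x y F')) ⟨
      coloursCount n m cs x y + (countEdge x y F' + 0)
        ≡⟨ cong (coloursCount n m cs x y +_) (liftEdges-across (λ _ _ → 0) (λ _ _ → refl) i j a≢b F) ⟩
      coloursCount n m cs x y + hits r (countEdge a b F + 0)
        ≡⟨ cong (λ k → coloursCount n m cs x y + hits r k) (+-identityʳ (countEdge a b F)) ⟩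
      coloursCount n m cs x y + hits r (countEdge a b F)
        ≡⟨ across i j a≢b ⟩
      hits r (cyclesCount a b (cycles D) + countEdge a b F)
        ≡⟨ cong (hits r) (≡.trans (partition D a b a≢b) (cong (λ e → if e then 0 else l * m) (==-≢ a≢b))) ⟩
      hits r (l * m)
        ≡⟨ hits-multiple r l (m%n<n (toℕ i + toℕ j) m) ⟩
      l ∎
      where
      open ≡-Reasoning
      x = combine a i
      y = combine b j
      r = (toℕ i + toℕ j) % m

  -- A star around index zero suffices: in the final colour a vertex lies on one trail only, so
  -- being on a common trail is transitive.
  twin : Fin n × Fin m' → V × V
  twin (a , i) = combine a zero , combine a (suc i)

  twinPairs : List (V × V)
  twinPairs = map twin (cartesianProduct (allFin n) (allFin m'))

  twinPairs-twins : All (TwinPair n m) twinPairs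
  twinPairs-twins = All-map⁺ (All.universal
    (λ (a , i) → (λ eq → case proj₂ (combine-injective a zero a (suc i) eq) of λ ()) ,
                 ≡.trans (part-combine n m a zero) (sym (part-combine n m a (suc i))))
    (cartesianProduct (allFin n) (allFin m')))

  -- Twins being joined and consecutive parts being linked, the closed trail through one vertex of the colour
  -- absorbs all others.
  extractCycle : ∀ {C} → IsCycle C → (c : Colour n m C twinPairs) →
    ∃ λ D → LiftedCycle n m C D × (∀ u v → cycleCount u v D ≡ colourCount n m c u v)
  extractCycle {a₀ ∷ C'} (uniq , len) c with isolate x₀ (closed c) (≡1⇒≢0 x₀-once)
    where
    open Colour
    x₀ = combine a₀ zero
    x₀-once : occurrences x₀ (concat (closed c)) ≡ 1
    x₀-once = ≡.trans (through c x₀) (cong 𝟙 (≡.trans (cong (λ a → occurs a (a₀ ∷ C')) (part-combine n m a₀ zero)) (∈⇒occurs {v = a₀} {a₀ ∷ C'} (here refl))))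
  ... | D' , W , c⊑ = D , record
        { isCycle = D-unique , subst (2 ≤_) (sym D-length) (≤-trans len (m≤m*n (length C) m))
        ; lifted-length = D-length
        ; lifted-occurs = λ x → 𝟙-injective (≡.trans (sym (occurrences-unique x D-unique)) (D-occurrences x))
        } , λ u v → ≡.trans (sym (+-identityʳ _)) (≡.trans (cong (cycleCount u v D +_) (sym (cyclesCount-absent u v W (rest-empty u)))) (sym (counts c⊑ u v)))
    where
    open Colour
    C = a₀ ∷ C'
    x₀ = combine a₀ zero
    D = x₀ ∷ D'

    total : ∀ x → occurrences x D + occurrences x (concat W) ≡ 𝟙 (occurs (part n m x) C)
    total x = ≡.trans (sym (occurrences-++ x D (concat W))) (≡.trans (sym (occs c⊑ x)) (through c x))

    -- If the trail shared by x and y were not D, then x would occur both on D and elsewhere, hence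
    -- twice in its colour.
    follow : ∀ {x y} → 1 ≤ occurrences x D → Joined (closed c) x y → 1 ≤ occurrences y D
    follow {x} {y} x∈ j with joins c⊑ x y j
    ... | here (_ , y∈) = y∈
    ... | there j' = contradiction (≤-trans (+-mono-≤ x∈ (Joined⇒occurs j')) (≤-trans (≤-reflexive (total x)) (𝟙≤1 _)))
                       λ { (s≤s ()) }

    twin-joined : ∀ {a} → occurs a C ≡ true → ∀ i → Joined (closed c) (combine a zero) (combine a (suc i))
    twin-joined {a} o i = All.lookup (twin-joins c) (∈-map⁺ twin (∈-cartesianProduct⁺ (∈-allFin a) (∈-allFin i)))
      (≡.trans (cong (λ b → occurs b C) (part-combine n m a zero)) o)

    spread : ∀ {a} → occurs a C ≡ true → ∀ i → 1 ≤ occurrences (combine a i) D → ∀ j → 1 ≤ occurrences (combine a j) D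
    spread o zero h zero = h
    spread o zero h (suc j) = follow h (twin-joined o j)
    spread o (suc i) h zero = follow h (Joined-sym (twin-joined o i))
    spread o (suc i) h (suc j) = follow (follow h (Joined-sym (twin-joined o i))) (twin-joined o j)

    -- All of the part over a lies on D, so D meets the lifted edge over a b, reaches one vertex
    -- over b and spreads from there over that part.
    travel : ∀ a L → All (λ b → occurs b C ≡ true) (a ∷ L) →
      All (λ (a , b) → ∃₂ λ i j → Joined (closed c) (combine a i) (combine b j)) (pathEdges (a ∷ L)) →
      (∀ i → 1 ≤ occurrences (combine a i) D) → All (λ b → ∀ i → 1 ≤ occurrences (combine b i) D) (a ∷ L)
    travel a [] _ _ h = h ∷ []
    travel a (b ∷ L) (_ ∷ os@(o ∷ _)) ((i , j , e) ∷ es) h = h ∷ travel b L os es (spread o j (follow (h i) e))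

    everywhere : All (λ b → ∀ i → 1 ≤ occurrences (combine b i) D) (a₀ ∷ C' ++ a₀ ∷ [])
    everywhere = travel a₀ (C' ++ a₀ ∷ [])
      (All-++⁺ {xs = C} (All.tabulate ∈⇒occurs) (∈⇒occurs {v = a₀} {C} (here refl) ∷ []))
      (subst (All _) (cycleEdges-pathEdges a₀ C') (edge-joins c))
      (spread (∈⇒occurs {v = a₀} {C} (here refl)) zero present)
      where
      present : 1 ≤ occurrences x₀ D
      present rewrite ==-≡ {a = x₀} refl = s≤s z≤n

    covered : ∀ x → occurs (part n m x) C ≡ true → 1 ≤ occurrences x D
    covered = fibrewise n m _ λ a i o → All.lookup everywhere
      (∈-++⁺ˡ (occurs⇒∈ a C (≡.trans (cong (λ b → occurs b C) (sym (part-combine n m a i))) o))) i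

    -- A vertex above C has its only occurrence on D already, and any other vertex has none.
    rest-empty : ∀ x → occurrences x (concat W) ≡ 0
    rest-empty x with occurs (part n m x) C in eq
    ... | false = m+n≡0⇒n≡0 (occurrences x D) (≡.trans (total x) (cong 𝟙 eq))
    ... | true = n≤0⇒n≡0 (+-cancelˡ-≤ 1 _ 0 (≤-trans (+-monoˡ-≤ _ (covered x eq))
                   (≤-reflexive (≡.trans (total x) (cong 𝟙 eq)))))

    D-occurrences : ∀ x → occurrences x D ≡ 𝟙 (occurs (part n m x) C)
    D-occurrences x = ≡.trans (sym (+-identityʳ _)) (≡.trans (cong (occurrences x D +_) (sym (rest-empty x))) (total x))

    D-unique : Unique D
    D-unique = occurrences≤1⇒Unique D λ x → ≤-trans (≤-reflexive (D-occurrences x)) (𝟙≤1 _)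

    D-length : length D ≡ length C * m
    D-length = begin
      length D
        ≡⟨ ∑-occurrences D ⟨
      ∑ (λ x → occurrences x D)
        ≡⟨ ∑-combine n m (λ x → occurrences x D) ⟩
      ∑ {n} (λ a → ∑ {m} (λ i → occurrences (combine a i) D))
        ≡⟨ sum-cong-≗ (λ a → ≡.trans (sum-cong-≗ {m} (λ i → fibre a i)) (∑-const m (occurrences a C))) ⟩
      ∑ (λ a → occurrences a C * m)
        ≡⟨ *-distribʳ-sum m (λ a → occurrences a C) ⟨
      ∑ (λ a → occurrences a C) * m
        ≡⟨ cong (_* m) (∑-occurrences C) ⟩
      length C * m ∎
      where
      open ≡-Reasoning
      fibre : ∀ a i → occurrences (combine a i) D ≡ occurrences a C
      fibre a i = ≡.trans (D-occurrences (combine a i))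
        (≡.trans (cong (λ b → 𝟙 (occurs b C)) (part-combine n m a i)) (sym (occurrences-unique a uniq)))

  extractCycles : ∀ {Cs} → All IsCycle Cs → (cs : Colours n m Cs twinPairs) →
    ∃ λ Ds → Pointwise (LiftedCycle n m) Cs Ds × (∀ u v → cyclesCount u v Ds ≡ coloursCount n m cs u v)
  extractCycles [] [] = [] , [] , λ u v → refl
  extractCycles (cyc ∷ cycs) (c ∷ cs) with extractCycle cyc c | extractCycles cycs cs
  ... | D , r , count | Ds , rs , counts = D ∷ Ds , r ∷ rs , λ u v → cong₂ _+_ (count u v) (counts u v)

theorem4p1 : (α l m n : ℕ) → 1 ≤ α → 1 ≤ l → 1 ≤ m → 1 ≤ n →
    (cs : List ℕ) →
    AdmitsResolvable α n (completeMult n (l * m)) cs →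
    AdmitsResolvable α (n * m) (partiteMult n m l) (map (λ c → c * m) cs)
theorem4p1 α l m@(suc m') n _ _ _ _ cs (D , classes , arranged , resolves)
  with rejoinTwins n m l twinPairs twinPairs-twins (proj₁ (initialState D)) (proj₂ (initialState D))
  where open Construction n m' l using (twinPairs; twinPairs-twins; initialState)
... | (colours , F , factor) , balanced with Construction.extractCycles n m' l (areCycles D) colours
-- The lifts are rearranged in the same way as the cycles below them and then cut into classes at
-- the same places.
...   | Ds , lifted , count with Pointwise-↭ (↭-sym arranged) lifted
...     | _ , lifted' , arranged' with Pointwise-concat⁻ classes lifted'
...       | classes' , refl , liftedClasses = record
  { cycles = Ds
  ; areCycles = lifted-cycles n m lifted
  ; lengths = ≡.trans (lifted-lengths n m lifted) (cong (map (λ c → c * m)) (lengths D))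
  ; oneFactor = F
  ; factorOK = factor
  ; partition = λ u v _ → ≡.trans (cong (_+ countEdge u v F) (count u v)) (balanced u v)
  } , classes' , ↭-sym arranged' , lifted-classes n m liftedClasses resolves
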